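{- Let $\mathcal H=(V,E)$ be a connected hypergraph, fix a ribbon structure on $\mathrm{Bip}\,\mathcal H$, a base node $b_0$ and a base edge $b_0b_1$. Let $\mathbf f$ be a hypertree on $E$ (respectively, on $V$). Then the (ht:$E$, cut:$V$) Bernardi process run on $\mathbf f$ (respectively, the (ht:$V$, cut:$V$) Bernardi process run on $\mathbf f$) takes each edge of $\mathrm{Bip}\,\mathcal H$ exactly once as current edge, and the current graph at the end of the process is a spanning tree of $\mathrm{Bip}\,\mathcal H$ realizing $\mathbf f$.
   Context: A hypergraph is a pair $\mathcal H=(V,E)$ with $V$ a finite set and $E$ a finite multiset of nonempty subsets of $V$. Its underlying bipartite graph $\mathrm{Bip}\,\mathcal H$ has color classes $V$ (violet nodes) and $E$ (emerald nodes), $v\in V$ being joined to $e\in E$ iff $v\in e$; $\mathcal H$ is connected if $\mathrm{Bip}\,\mathcal H$ is connected. A ribbon structure on a loopless graph is a choice, at every node $x$, of a cyclic permutation of the edges incident to $x$; for an edge $xy$, $xy^+$ denotes the edge following $xy$ in the cyclic order at $x$ (the first letter names the node at which the cyclic order is taken). Subgraphs inherit ribbon structures by restricting the cyclic orders; $xy^+_G$ denotes the successor taken in the subgraph $G$. A base node $b_0$ and an incident base edge $b_0b_1$ are fixed. For a bipartite graph with color classes $E,V$, a vector $\mathbf f:E\to\mathbb Z_{\ge 0}$ is a hypertree on $E$ if some spanning tree $T$ has degree $d_T(e)=\mathbf f(e)+1$ for all $e\in E$ (then $T$ realizes $\mathbf f$); hypertrees on $V$ are defined symmetrically. Bernardi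 processes: let $X\in\{E,V\}$ and $\mathbf f$ a hypertree on $X$. The process keeps a current graph $G$ (initially $\mathrm{Bip}\,\mathcal H$) and a current edge. (ht:$X$, cut:$V$): if $b_0\in V$ the first current edge is $b_0b_1$; if $b_0\in E$ the first current edge is $b_1b_0^+$ and $b_0b_1$ counts as traversed from its emerald endpoint. If the current edge is $ve$ ($v\in V$, $e\in E$): if $\mathbf f$ is a hypertree on $X$ in $G-ve$, then $ve$ is removed, the current graph becomes $G-ve$ and the next current edge is $ve^+_G$; otherwise $ve$ is traversed from $v$, the edge $ew:=ev^+_G$ is traversed from $e$, the graph stays $G$, and the next current edge is $we^+_G$. The process stops right before some edge would be traversed for the second time from the same endpoint. -}

module Defs where

open import Data.Nat using (ℕ; zero; suc; _+_)
open import Data.Fin using (Fin; zero; suc)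
open import Data.Fin.Properties using () renaming (_≟_ to _≟ᶠ_)
open import Data.Bool using (Bool; true; false; if_then_else_; _∧_)
open import Data.List using (List; []; _∷_; _++_; [_]; reverse)
open import Data.List.Membership.Propositional using (_∈_; _∉_)
open import Data.List.Relation.Unary.Unique.Propositional using (Unique)
open import Data.Maybe using (Maybe; just; nothing)
open import Data.Product using (Σ; ∃; _×_; _,_)
open import Data.Sum using (_⊎_; inj₁; inj₂)
open import Data.Empty using (⊥)
open import Relation.Nullary using (¬_; yes; no)
open import Relation.Nullary.Decidable using (⌊_⌋)
open import Relation.Binary.PropositionalEquality using (_≡_)
open import Relation.Binary.Construct.Closure.ReflexiveTransitive using (Star)
open import Function.Bundles using (_⇔_)

-- Cyclic orders are given by duplicate-free lists read cyclically.

rotAfter : ∀ {k} → Fin k → List (Fin k) → List (Fin k)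
rotAfter {k} y = go []
  where
  go : List (Fin k) → List (Fin k) → List (Fin k)
  go acc [] = reverse acc
  go acc (x ∷ xs) with x ≟ᶠ y
  ... | yes _ = xs ++ (reverse acc ++ [ x ])
  ... | no _ = go (x ∷ acc) xs

firstWith : ∀ {k} → (Fin k → Bool) → List (Fin k) → Maybe (Fin k)
firstWith p [] = nothing
firstWith p (x ∷ xs) = if p x then just x else firstWith p xs

-- successor of y in the cyclic order L restricted to elements satisfying p
-- (y itself if no element satisfies p; this never matters in the process)
cycSucc : ∀ {k} → List (Fin k) → (Fin k → Bool) → Fin k → Fin k
cycSucc L p y with firstWith p (rotAfter y L)
... | just z = z
... | nothing = y

count : ∀ {k} → (Fin k → Bool) → ℕ
count {zero} f = 0
count {suc k} f = (if f zero then 1 else 0) + count (λ i → f (suc i))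

data Color : Set where
  violet emerald : Color

data Side : Set where
  fromV fromE : Side

-- A hypergraph with V = Fin n, E = Fin m (E indexed, so a multiset),
-- given by H e v = true iff v ∈ e.

module Bip {n m : ℕ} (H : Fin m → Fin n → Bool) where

  -- spanning subgraphs of Bip H (node set V ⊎ E), given by their edge sets
  Sub : Set
  Sub = Fin n → Fin m → Bool

  Full : Sub
  Full v e = H e v

  Node : Set
  Node = Fin n ⊎ Fin m

  Adj : Sub → Node → Node → Set
  Adj G (inj₁ v) (inj₂ e) = G v e ≡ true
  Adj G (inj₂ e) (inj₁ v) = G v e ≡ true
  Adj G (inj₁ _) (inj₁ _) = ⊥
  Adj G (inj₂ _) (inj₂ _) = ⊥

  Connected : Sub → Set
  Connected G = ∀ x y → Star (Adj G) x y

  _─_ : Sub → Fin n × Fin m → Sub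
  (G ─ (v , e)) v' e' = if ⌊ v' ≟ᶠ v ⌋ ∧ ⌊ e' ≟ᶠ e ⌋ then false else G v' e'

  _⊆_ : Sub → Sub → Set
  T ⊆ G = ∀ v e → T v e ≡ true → G v e ≡ true

  -- T is a spanning tree of G: a connected spanning subgraph of G that is
  -- acyclic (every edge of T is a bridge of T)
  IsSpanningTree : Sub → Sub → Set
  IsSpanningTree G T =
    T ⊆ G × Connected T ×
    (∀ v e → T v e ≡ true → ¬ Star (Adj (T ─ (v , e))) (inj₁ v) (inj₂ e))

  degV : Sub → Fin n → ℕ
  degV T v = count (λ e → T v e)

  degE : Sub → Fin m → ℕ
  degE T e = count (λ v → T v e)

  Weight : Color → Set
  Weight violet = Fin n → ℕ
  Weight emerald = Fin m → ℕ

  Realizes : (X : Color) → Weight X → Sub → Set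
  Realizes violet f T = ∀ v → degV T v ≡ suc (f v)
  Realizes emerald f T = ∀ e → degE T e ≡ suc (f e)

  IsHypertree : (X : Color) → Weight X → Sub → Set
  IsHypertree X f G = ∃ λ T → IsSpanningTree G T × Realizes X f T

  -- ribbon structure: a cyclic order at every node of the incident edges,
  -- i.e. of the neighbouring nodes, as a duplicate-free list read cyclically
  record Ribbon : Set where
    field
      atV : Fin n → List (Fin m)
      atE : Fin m → List (Fin n)
      atV-unique : ∀ v → Unique (atV v)
      atE-unique : ∀ e → Unique (atE e)
      atV-mem : ∀ v e → (e ∈ atV v) ⇔ (H e v ≡ true)
      atE-mem : ∀ e v → (v ∈ atE e) ⇔ (H e v ≡ true)

  Edge : Set
  Edge = Fin n × Fin m

  Trav : Set
  Trav = Fin n × Fin m × Side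

  record State : Set where
    constructor st
    field
      graph : Sub
      curV : Fin n
      curE : Fin m
      traversed : List Trav
      history : List Edge

  module Process (ρ : Ribbon) (X : Color) (f : Weight X) where
    open Ribbon ρ

    succV : Sub → Fin n → Fin m → Fin m
    succV G v e = cycSucc (atV v) (λ e' → G v e') e

    succE : Sub → Fin m → Fin n → Fin n
    succE G e v = cycSucc (atE e) (λ v' → G v' e) v

    init : (b0 b1 : Node) → Adj Full b0 b1 → State
    init (inj₁ v) (inj₂ e) _ = st Full v e [] []
    init (inj₂ e) (inj₁ v) _ = st Full v (succV Full v e) ((v , e , fromE) ∷ []) []

    data Step : State → State → Set where
      removeStep : ∀ {G v e tr hs} →
        IsHypertree X f (G ─ (v , e)) →
        Step (st G v e tr hs)
             (st (G ─ (v , e)) v (succV G v e) tr (hs ++ [ (v , e) ]))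
      traverseStep : ∀ {G v e tr hs} →
        ¬ IsHypertree X f (G ─ (v , e)) →
        (v , e , fromV) ∉ tr →
        (succE G e v , e , fromE) ∉ tr →
        Step (st G v e tr hs)
             (st G (succE G e v) (succV G (succE G e v) e)
                 ((succE G e v , e , fromE) ∷ (v , e , fromV) ∷ tr)
                 (hs ++ [ (v , e) ]))

    -- the process stops right before an edge would be traversed a second
    -- time from the same endpoint; Ends s T hs: from state s the process
    -- stops with final current graph T and list hs of current edges
    data Ends : State → Sub → List Edge → Set where
      stopAtVE : ∀ {G v e tr hs} →
        ¬ IsHypertree X f (G ─ (v , e)) →
        (v , e , fromV) ∈ tr →
        Ends (st G v e tr hs) G hs
      stopAtEW : ∀ {G v e tr hs} →
        ¬ IsHypertree X f (G ─ (v , e)) →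
        (v , e , fromV) ∉ tr →
        (succE G e v , e , fromE) ∈ tr →
        Ends (st G v e tr hs) G (hs ++ [ (v , e) ])

{-# OPTIONS --safe #-}
-- Call an edge of the current graph G mandatory if the hypertree f is lost when it is removed,
-- i.e. if it lies in every spanning tree of G realizing f.  An edge traversed from its violet end
-- is mandatory, and the traversals follow a face of the ribbon graph G.
--
-- Key fact: G has no simple cycle of length at least 4 all of whose edges directed from violet to
-- emerald are mandatory, since otherwise exchanges in a realizing tree would remove one of them.
-- So if a closed walk crosses an edge from its violet end and its violet-to-emerald steps are
-- mandatory, it also crosses that edge backwards.  If moreover it is a face walk, rotating around
-- its nodes shows that it crosses every edge of G in both directions.
--
-- Hence an edge first traversed from its emerald end is never removed (the walk in between would
-- be such a face walk after the removal), so the process never destroys its own past; and when a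
-- traversal is about to be repeated, every edge of G is mandatory, so that G is itself the tree.

module Submission where

open import Defs
open import Data.Bool using (Bool; true; false)
import Data.Bool.Properties as Bool
open import Data.Empty using (⊥)
open import Data.Fin using (Fin; zero; suc; combine; remQuot)
open import Data.Fin.Properties using (all?; remQuot-combine; suc-injective; combine-injective; injective⇒≤) renaming (_≟_ to _≟ᶠ_)
open import Data.Fin.Subset using (Subset)
open import Data.Fin.Subset.Properties using (anySubset?)
open import Data.List using (List; []; _∷_; _++_; [_]; reverse; cartesianProduct; allFin; length; lookup; _∷ʳ_; initLast; InitLast; _∷ʳ′_)
import Data.List.Membership.DecPropositional as DecMembership
open import Data.List.Membership.Propositional using (_∈_; _∉_)
open import Data.List.Membership.Propositional.Properties using (∈-∃++; ∈-++⁺ˡ; ∈-++⁺ʳ; ∈-++⁻; ∈-cartesianProduct⁺; ∈-allFin; ∈-lookup)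
open import Data.List.Properties using (++-assoc; ++-identityʳ; unfold-reverse; length-++)
open import Data.List.Relation.Binary.Permutation.Propositional using (↭⇒↭ₛ)
open import Data.List.Relation.Binary.Permutation.Propositional.Properties using (++-comm)
import Data.List.Relation.Binary.Permutation.Setoid.Properties as PermSetoid
open import Data.List.Relation.Unary.All as All using (All; []; _∷_)
open import Data.List.Relation.Unary.AllPairs using ([]; _∷_)
open import Data.List.Relation.Unary.Any using (here; there)
open import Data.List.Relation.Unary.Linked as Linked using (Linked; []; [-]; _∷_)
open import Data.List.Relation.Unary.Unique.Propositional using (Unique)
import Data.List.Relation.Unary.Unique.Propositional.Properties as Unique
open import Data.Maybe using (just)
open import Data.Nat using (ℕ; zero; suc; _+_; _*_; _≤_; _<_; z≤n; s≤s; z<s)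
open import Data.Nat.Induction using (<-rec)
import Data.Nat.Properties as ℕ
open import Data.Product using (∃; _×_; _,_; proj₁; proj₂; uncurry)
open import Data.Product.Properties using () renaming (≡-dec to ×-≡-dec)
open import Data.Sum using (_⊎_; inj₁; inj₂; swap)
open import Data.Sum.Properties using (inj₂-injective) renaming (≡-dec to ⊎-≡-dec)
import Data.Vec as Vec
open import Data.Vec.Properties using (lookup∘tabulate)
open import Function using (_∘_; _∋_; id; flip)
open import Function.Bundles using (_⇔_; mk⇔; Equivalence)
open import Relation.Binary.Construct.Closure.ReflexiveTransitive as Star using (Star; ε; _◅_; _◅◅_; gmap)
open import Relation.Binary.Definitions using (DecidableEquality)
open import Relation.Binary.PropositionalEquality using (_≡_; _≢_; refl; sym; trans; cong; subst; module ≡-Reasoning; cong₂)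
open import Relation.Binary.PropositionalEquality.Properties using (setoid)
open import Relation.Nullary using (yes; no; contradiction; Dec; ¬_)
open import Relation.Nullary.Decidable using (_×-dec_; _⊎-dec_; ¬?; _→-dec_) renaming (map′ to mapDec)

-- Cyclic successors

-- The recursion inside rotAfter is a local function of Defs, so it cannot be named;
-- here it is recovered by unification, with the accumulator made variable.
mutual
  rotFrom : ∀ {k} → Fin k → List (Fin k) → List (Fin k) → List (Fin k)
  rotFrom y acc xs = _

  rotFrom-defined : ∀ {k} (y : Fin k) xs → rotAfter y xs ≡ rotAfter y xs
  rotFrom-defined {k} y xs with List.[] {A = Fin k}
  ... | acc = refl {x = rotFrom y acc xs}

rotFrom-split : ∀ {k} (y : Fin k) acc as bs → y ∉ as →
  rotFrom y acc (as ++ y ∷ bs) ≡ bs ++ (reverse acc ++ as) ++ [ y ]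
rotFrom-split y acc [] bs y∉ with y ≟ᶠ y
... | yes _ = cong (λ l → bs ++ l ++ [ y ]) (sym (++-identityʳ (reverse acc)))
... | no y≢y = contradiction refl y≢y
rotFrom-split y acc (a ∷ as) bs y∉ with a ≟ᶠ y
... | yes a≡y = contradiction (here (sym a≡y)) y∉
... | no _ = begin
  rotFrom y (a ∷ acc) (as ++ y ∷ bs)        ≡⟨ rotFrom-split y (a ∷ acc) as bs (y∉ ∘ there) ⟩
  bs ++ (reverse (a ∷ acc) ++ as) ++ [ y ]  ≡⟨ cong (λ l → bs ++ (l ++ as) ++ [ y ]) (unfold-reverse a acc) ⟩
  bs ++ ((reverse acc ++ [ a ]) ++ as) ++ [ y ]
    ≡⟨ cong (λ l → bs ++ l ++ [ y ]) (++-assoc (reverse acc) [ a ] as) ⟩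
  bs ++ (reverse acc ++ a ∷ as) ++ [ y ]    ∎
  where open ≡-Reasoning

rotAfter-split : ∀ {k} (y : Fin k) as bs → y ∉ as →
  rotAfter y (as ++ y ∷ bs) ≡ bs ++ as ++ [ y ]
rotAfter-split y as bs = rotFrom-split y [] as bs

unique-split : ∀ {a} {A : Set a} as {y : A} {bs} → Unique (as ++ y ∷ bs) → y ∉ as × y ∉ bs
unique-split [] (y≢ ∷ _) = (λ ()) , λ y∈bs → All.lookup y≢ y∈bs refl
unique-split (a ∷ as) {y} (a≢ ∷ u) with unique-split as u
... | y∉as , y∉bs = (λ { (here refl) → All.lookup a≢ (∈-++⁺ʳ as (here refl)) refl
                      ; (there y∈as) → y∉as y∈as }) , y∉bs

module _ {k : ℕ} where

  firstWith-++ˡ : ∀ (p : Fin k → Bool) xs {ys z} → firstWith p xs ≡ just z → firstWith p (xs ++ ys) ≡ just z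
  firstWith-++ˡ p (x ∷ xs) eq with p x
  ... | true = eq
  ... | false = firstWith-++ˡ p xs eq

  firstWith-sat : ∀ (p : Fin k → Bool) xs {z} → firstWith p xs ≡ just z → p z ≡ true × z ∈ xs
  firstWith-sat p (x ∷ xs) eq with p x in px
  firstWith-sat p (x ∷ xs) refl | true = px , here refl
  ... | false with firstWith-sat p xs eq
  ... | pz , z∈ = pz , there z∈

  firstWith-∃ : ∀ (p : Fin k → Bool) {x} xs → x ∈ xs → p x ≡ true → ∃ λ z → firstWith p xs ≡ just z
  firstWith-∃ p (x ∷ xs) x∈ px with p x in eq
  ... | true = x , refl
  firstWith-∃ p (x ∷ xs) (here refl) px | false with trans (sym px) eq
  ... | ()
  firstWith-∃ p (x ∷ xs) (there x∈) px | false = firstWith-∃ p xs x∈ px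

  firstWith-weaken : ∀ (p q : Fin k → Bool) xs {z} → (∀ x → q x ≡ true → p x ≡ true) →
    firstWith p xs ≡ just z → q z ≡ true → firstWith q xs ≡ just z
  firstWith-weaken p q (x ∷ xs) q⊆p eq qz with p x in px | q x in qx
  ... | true | true = eq
  firstWith-weaken p q (x ∷ xs) q⊆p refl qz | true | false with trans (sym qz) qx
  ... | ()
  firstWith-weaken p q (x ∷ xs) q⊆p eq qz | false | true with trans (sym px) (q⊆p x qx)
  ... | ()
  firstWith-weaken p q (x ∷ xs) q⊆p eq qz | false | false = firstWith-weaken p q xs q⊆p eq qz

  firstWith-cong : ∀ (p q : Fin k → Bool) xs → (∀ {x} → x ∈ xs → p x ≡ q x) → firstWith p xs ≡ firstWith q xs
  firstWith-cong p q [] p≗q = refl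
  firstWith-cong p q (x ∷ xs) p≗q with p x | q x | p≗q (here refl)
  ... | true | .true | refl = refl
  ... | false | .false | refl = firstWith-cong p q xs (p≗q ∘ there)

  firstWith-split : ∀ (p : Fin k → Bool) xs {z} → firstWith p xs ≡ just z →
    ∃ λ as → ∃ λ bs → xs ≡ as ++ z ∷ bs × (∀ {x} → x ∈ as → p x ≡ false)
  firstWith-split p (x ∷ xs) eq with p x in px
  firstWith-split p (x ∷ xs) refl | true = [] , xs , refl , λ ()
  ... | false with firstWith-split p xs eq
  ... | as , bs , refl , pas = x ∷ as , bs , refl , λ { (here refl) → px ; (there x∈) → pas x∈ }

  firstWith-skip : ∀ (p : Fin k → Bool) as bs → (∀ {x} → x ∈ as → p x ≡ false) →
    firstWith p (as ++ bs) ≡ firstWith p bs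
  firstWith-skip p [] bs pas = refl
  firstWith-skip p (a ∷ as) bs pas with p a | pas (here refl)
  ... | false | refl = firstWith-skip p as bs (pas ∘ there)

  cycSucc-first : ∀ (L : List (Fin k)) p y {z} → firstWith p (rotAfter y L) ≡ just z → cycSucc L p y ≡ z
  cycSucc-first L p y eq with firstWith p (rotAfter y L)
  cycSucc-first L p y refl | just z = refl

  unique-comm : ∀ (l r : List (Fin k)) → Unique (l ++ r) → Unique (r ++ l)
  unique-comm l r = PermSetoid.Unique-resp-↭ (setoid (Fin k)) (↭⇒↭ₛ (++-comm l r))

  rotAfter-rotateˡ : ∀ l r {z} → Unique (l ++ r) → z ∈ l → rotAfter z (l ++ r) ≡ rotAfter z (r ++ l)
  rotAfter-rotateˡ l r {z} u z∈l with ∈-∃++ z∈l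
  ... | as , bs , refl = begin
    rotAfter z ((as ++ z ∷ bs) ++ r)  ≡⟨ cong (rotAfter z) (++-assoc as (z ∷ bs) r) ⟩
    rotAfter z (as ++ z ∷ bs ++ r)    ≡⟨ rotAfter-split z as (bs ++ r) z∉as ⟩
    (bs ++ r) ++ as ++ [ z ]          ≡⟨ ++-assoc bs r _ ⟩
    bs ++ r ++ as ++ [ z ]            ≡⟨ cong (bs ++_) (sym (++-assoc r as [ z ])) ⟩
    bs ++ (r ++ as) ++ [ z ]          ≡⟨ sym (rotAfter-split z (r ++ as) bs z∉ras) ⟩
    rotAfter z ((r ++ as) ++ z ∷ bs)  ≡⟨ cong (rotAfter z) (++-assoc r as (z ∷ bs)) ⟩
    rotAfter z (r ++ as ++ z ∷ bs)    ∎
    where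
    open ≡-Reasoning
    z∉as : z ∉ as
    z∉as = proj₁ (unique-split as (subst Unique (++-assoc as (z ∷ bs) r) u))
    z∉ras : z ∉ r ++ as
    z∉ras = proj₁ (unique-split (r ++ as)
      (subst Unique (sym (++-assoc r as (z ∷ bs))) (unique-comm (as ++ z ∷ bs) r u)))

  rotAfter-rotate : ∀ (l r : List (Fin k)) {z} → Unique (l ++ r) → z ∈ l ++ r →
    rotAfter z (l ++ r) ≡ rotAfter z (r ++ l)
  rotAfter-rotate l r u z∈ with ∈-++⁻ l z∈
  ... | inj₁ z∈l = rotAfter-rotateˡ l r u z∈l
  ... | inj₂ z∈r = sym (rotAfter-rotateˡ r l (unique-comm l r u) z∈r)

  firstWith-snoc : ∀ {p : Fin k → Bool} xs {z} → p z ≡ false → firstWith p (xs ++ [ z ]) ≡ firstWith p xs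
  firstWith-snoc {p} [] {z} pz with p z
  firstWith-snoc [] refl | false = refl
  firstWith-snoc {p} (x ∷ xs) pz with p x
  ... | true = refl
  ... | false = firstWith-snoc xs pz

  module _ {L : List (Fin k)} (uniq : Unique L) where

    rotAfter-view : ∀ {y} → y ∈ L → ∃ λ as → ∃ λ bs →
      L ≡ as ++ y ∷ bs × rotAfter y L ≡ bs ++ as ++ [ y ] × y ∉ as × y ∉ bs
    rotAfter-view y∈ with ∈-∃++ y∈
    ... | as , bs , refl with unique-split as uniq
    ... | y∉as , y∉bs = as , bs , refl , rotAfter-split _ as bs y∉as , y∉as , y∉bs

    self∈rotAfter : ∀ {y} → y ∈ L → y ∈ rotAfter y L
    self∈rotAfter y∈ with rotAfter-view y∈
    ... | as , bs , _ , eq , _ rewrite eq = ∈-++⁺ʳ bs (∈-++⁺ʳ as (here refl))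

    firstWith-cycSucc : ∀ p {y} → y ∈ L → p y ≡ true → firstWith p (rotAfter y L) ≡ just (cycSucc L p y)
    firstWith-cycSucc p {y} y∈ py with firstWith-∃ p (rotAfter y L) (self∈rotAfter y∈) py
    ... | z , eq = trans eq (cong just (sym (cycSucc-first L p y eq)))

    cycSucc-sat : ∀ p {y} → y ∈ L → p y ≡ true → p (cycSucc L p y) ≡ true
    cycSucc-sat p {y} y∈ py = proj₁ (firstWith-sat p (rotAfter y L) (firstWith-cycSucc p y∈ py))

    -- Passing to a smaller set changes a successor only by omitting it, since no `q`-element can
    -- come before the first `p`-element. Consecutive traversals that survive a removal therefore
    -- stay consecutive.
    cycSucc-stable : ∀ p q {y} → (∀ x → q x ≡ true → p x ≡ true) → y ∈ L → q y ≡ true →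
      q (cycSucc L p y) ≡ true → cycSucc L q y ≡ cycSucc L p y
    cycSucc-stable p q {y} q⊆p y∈ qy qs =
      cycSucc-first L q y (firstWith-weaken p q (rotAfter y L) q⊆p (firstWith-cycSucc p y∈ (q⊆p y qy)) qs)

    -- The rotation at `y` is itself a rotation of `L`, so the rotation at `z` can be read off from
    -- it.
    rotAfter-shift : ∀ {y z} as bs → y ∈ L → rotAfter y L ≡ as ++ z ∷ bs → rotAfter z L ≡ bs ++ as ++ [ z ]
    rotAfter-shift {y} {z} as bs y∈ eq with rotAfter-view y∈
    ... | l , r , refl , rot , _ = begin
      rotAfter z (l ++ y ∷ r)          ≡⟨ cong (rotAfter z) (sym (++-assoc l [ y ] r)) ⟩
      rotAfter z ((l ++ [ y ]) ++ r)   ≡⟨ rotAfter-rotate (l ++ [ y ]) r u z∈ ⟩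
      rotAfter z (r ++ l ++ [ y ])     ≡⟨ cong (rotAfter z) asbs ⟩
      rotAfter z (as ++ z ∷ bs)        ≡⟨ rotAfter-split z as bs (proj₁ (unique-split as u')) ⟩
      bs ++ as ++ [ z ]                ∎
      where
      open ≡-Reasoning
      asbs : r ++ l ++ [ y ] ≡ as ++ z ∷ bs
      asbs = trans (sym rot) eq
      u : Unique ((l ++ [ y ]) ++ r)
      u = subst Unique (sym (++-assoc l [ y ] r)) uniq
      u' : Unique (as ++ z ∷ bs)
      u' = subst Unique asbs (unique-comm (l ++ [ y ]) r u)
      z∈ : z ∈ (l ++ [ y ]) ++ r
      z∈ with ∈-++⁻ r (subst (z ∈_) (sym asbs) (∈-++⁺ʳ as (here refl)))
      ... | inj₁ z∈r = ∈-++⁺ʳ (l ++ [ y ]) z∈r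
      ... | inj₂ z∈l = ∈-++⁺ˡ z∈l

    rotAfter-unique : ∀ {y} → y ∈ L → Unique (rotAfter y L)
    rotAfter-unique {y} y∈ with rotAfter-view y∈
    ... | as , bs , refl , eq , _ = subst Unique (sym eq)
      (unique-comm (as ++ [ y ]) bs (subst Unique (sym (++-assoc as [ y ] bs)) uniq))

    rotAfter-complete : ∀ {x y} → y ∈ L → x ∈ L → x ∈ rotAfter y L
    rotAfter-complete {x} {y} y∈ x∈ with rotAfter-view y∈
    ... | as , bs , refl , eq , _ rewrite eq with ∈-++⁻ as x∈
    ... | inj₁ x∈as = ∈-++⁺ʳ bs (∈-++⁺ˡ x∈as)
    ... | inj₂ (here refl) = ∈-++⁺ʳ bs (∈-++⁺ʳ as (here refl))
    ... | inj₂ (there x∈bs) = ∈-++⁺ˡ x∈bs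

    module _ (p : Fin k → Bool) (p⊆L : ∀ x → p x ≡ true → x ∈ L) where

      -- Sweeps the rotation at y: u is the last p-element met so far, so that its successor is the next one.
      cycSucc-orbit : ∀ {ℓ} (P : Fin k → Set ℓ) → (∀ x → p x ≡ true → P x → P (cycSucc L p x)) →
        ∀ {y} → p y ≡ true → P y → ∀ x → p x ≡ true → P x
      cycSucc-orbit P closed {y} py Py x px =
        sweep [] (rotAfter y L) y refl py Py (cong (firstWith p) (sym (++-identityʳ (rotAfter y L))))
          x (rotAfter-complete (p⊆L y py) (p⊆L x px)) px
        where
        sweep : ∀ l r u → rotAfter y L ≡ l ++ r → p u ≡ true → P u →
          firstWith p (rotAfter u L) ≡ firstWith p (r ++ l) → ∀ x → x ∈ r → p x ≡ true → P x
        sweep l (z ∷ r) u split pu Pu next with p z in pz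
        ... | true = λ { x (here refl) px → Pz
                       ; x (there x∈) px → sweep (l ++ [ z ]) r z (trans split (sym (++-assoc l [ z ] r))) pz Pz
                           (cong (firstWith p) (rotAfter-shift l r (p⊆L y py) split)) x x∈ px }
          where
          Pz : P z
          Pz = subst P (cycSucc-first L p u next) (closed u pu Pu)
        ... | false = λ { x (here refl) px → contradiction (trans (sym px) pz) λ ()
                        ; x (there x∈) px → sweep (l ++ [ z ]) r u (trans split (sym (++-assoc l [ z ] r))) pu Pu
                           (trans next (trans (sym (firstWith-snoc (r ++ l) pz)) (cong (firstWith p) (++-assoc r l [ z ])))) x x∈ px }

      -- A fixed point would be an orbit of its own, while the successor is transitive on the
      -- `p`-elements.
      cycSucc-≢ : ∀ {x y} → p x ≡ true → p y ≡ true → x ≢ y → cycSucc L p y ≢ y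
      cycSucc-≢ {x} {y} px py x≢y fix =
        x≢y (cycSucc-orbit (_≡ y) (λ { _ _ refl → fix }) py refl x px)

      -- The rotation at `x` reads `as`, `e`, `bs` with no `p`-element in `as`. Once `e` is deleted,
      -- `x` inherits the successor of `e`, which is found in `bs` because `bs` still contains `x`
      -- itself.
      cycSucc-remove : ∀ q {x e} → q e ≡ false → (∀ z → z ≢ e → p z ≡ q z) → p x ≡ true → x ≢ e →
        cycSucc L p x ≡ e → cycSucc L q x ≡ cycSucc L p e
      cycSucc-remove q {x} {e} qe p≗q px x≢e succ with firstWith-split p (rotAfter x L) found
        where
        found : firstWith p (rotAfter x L) ≡ just e
        found = trans (firstWith-cycSucc p (p⊆L x px) px) (cong just succ)
      ... | as , bs , split , pas with firstWith-∃ q bs x∈bs (trans (sym (p≗q x x≢e)) px)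
        where
        x∈bs : x ∈ bs
        x∈bs with ∈-++⁻ as (subst (x ∈_) split (self∈rotAfter (p⊆L x px)))
        ... | inj₁ x∈as = contradiction (trans (sym px) (pas x∈as)) λ ()
        ... | inj₂ (here x≡e) = contradiction x≡e x≢e
        ... | inj₂ (there x∈bs) = x∈bs
      ... | z , fz = trans (cycSucc-first L q x atx) (sym (cycSucc-first L p e ate))
        where
        e∉bs : e ∉ bs
        e∉bs = proj₂ (unique-split as (subst Unique split (rotAfter-unique (p⊆L x px))))
        q-as : ∀ {y} → y ∈ as → q y ≡ false
        q-as {y} y∈ with y ≟ᶠ e
        ... | yes refl = qe
        ... | no y≢e = trans (sym (p≗q y y≢e)) (pas y∈)
        atx : firstWith q (rotAfter x L) ≡ just z
        atx = trans (cong (firstWith q) split)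
             (trans (firstWith-skip q as (e ∷ bs) q-as)
             (trans (firstWith-skip q [ e ] bs λ { (here refl) → qe }) fz))
        ate : firstWith p (rotAfter e L) ≡ just z
        ate = trans (cong (firstWith p) (rotAfter-shift as bs (p⊆L x px) split))
          (firstWith-++ˡ p bs (trans (firstWith-cong p q bs λ y∈ → p≗q _ λ { refl → e∉bs y∈ }) fz))

-- Spanning trees and exchanges

count-cong : ∀ {k} {f g : Fin k → Bool} → (∀ i → f i ≡ g i) → count f ≡ count g
count-cong {zero} f≗g = refl
count-cong {suc k} f≗g rewrite f≗g zero = cong (_ +_) (count-cong (λ i → f≗g (suc i)))

count-insert : ∀ {k} {f g : Fin k → Bool} z → g z ≡ false → f z ≡ true →
  (∀ i → i ≢ z → f i ≡ g i) → count f ≡ suc (count g)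
count-insert zero gz fz f≗g rewrite gz | fz = cong suc (count-cong (λ i → f≗g (suc i) λ ()))
count-insert {g = g} (suc z) gz fz f≗g rewrite f≗g zero (λ ()) =
  trans (cong (_ +_) (count-insert z gz fz λ i i≢z → f≗g (suc i) (i≢z ∘ suc-injective))) (ℕ.+-suc _ _)

module Graph {n m : ℕ} (H : Fin m → Fin n → Bool) where
  open Bip H

  _≟ₙ_ : DecidableEquality Node
  _≟ₙ_ = ⊎-≡-dec _≟ᶠ_ _≟ᶠ_

  _≟ₑ_ : DecidableEquality Edge
  _≟ₑ_ = ×-≡-dec _≟ᶠ_ _≟ᶠ_

  Conn : Sub → Node → Node → Set
  Conn G = Star (Adj G)

  _∪ₑ_ : Sub → Edge → Sub
  (G ∪ₑ (v , e)) v' e' with (v' , e') ≟ₑ (v , e)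
  ... | yes _ = true
  ... | no _ = G v' e'

  ─-⊆ : ∀ G x → (G ─ x) ⊆ G
  ─-⊆ G (v , e) v' e' h with v' ≟ᶠ v | e' ≟ᶠ e
  ... | yes _ | no _ = h
  ... | no _ | _ = h

  ─-removed : ∀ G v e → (G ─ (v , e)) v e ≡ false
  ─-removed G v e with v ≟ᶠ v | e ≟ᶠ e
  ... | yes _ | yes _ = refl
  ... | no v≢v | _ = contradiction refl v≢v
  ... | _ | no e≢e = contradiction refl e≢e

  ─-other : ∀ G v e {v' e'} → (v' , e') ≢ (v , e) → (G ─ (v , e)) v' e' ≡ G v' e'
  ─-other G v e {v'} {e'} ne with v' ≟ᶠ v | e' ≟ᶠ e
  ... | yes refl | yes refl = contradiction refl ne
  ... | yes _ | no _ = refl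
  ... | no _ | _ = refl

  ─-≢ : ∀ G v e {v' e'} → (G ─ (v , e)) v' e' ≡ true → (v' , e') ≢ (v , e)
  ─-≢ G v e h refl = contradiction (trans (sym h) (─-removed G v e)) λ ()

  ─-kept : ∀ G v e {v' e'} → G v' e' ≡ true → (v' , e') ≢ (v , e) → (G ─ (v , e)) v' e' ≡ true
  ─-kept G v e h ne = trans (─-other G v e ne) h

  ─-mono : ∀ {G G'} x → G ⊆ G' → (G ─ x) ⊆ (G' ─ x)
  ─-mono {G} {G'} x@(v , e) G⊆G' v' e' h = ─-kept G' v e (G⊆G' v' e' (─-⊆ G x v' e' h)) (─-≢ G v e h)

  ∪ₑ-new : ∀ G v e → (G ∪ₑ (v , e)) v e ≡ true
  ∪ₑ-new G v e with (v , e) ≟ₑ (v , e)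
  ... | yes _ = refl
  ... | no ne = contradiction refl ne

  ∪ₑ-other : ∀ G x {v' e'} → (v' , e') ≢ x → (G ∪ₑ x) v' e' ≡ G v' e'
  ∪ₑ-other G x {v'} {e'} ne with (v' , e') ≟ₑ x
  ... | yes eq = contradiction eq ne
  ... | no _ = refl

  ⊆-∪ₑ : ∀ G x → G ⊆ (G ∪ₑ x)
  ⊆-∪ₑ G x v' e' h with (v' , e') ≟ₑ x
  ... | yes _ = refl
  ... | no _ = h

  Adj-mono : ∀ {G G'} → G ⊆ G' → ∀ {x y} → Adj G x y → Adj G' x y
  Adj-mono G⊆G' {inj₁ v} {inj₂ e} = G⊆G' v e
  Adj-mono G⊆G' {inj₂ e} {inj₁ v} = G⊆G' v e

  Adj-sym : ∀ {G} x y → Adj G x y → Adj G y x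
  Adj-sym (inj₁ v) (inj₂ e) = id
  Adj-sym (inj₂ e) (inj₁ v) = id

  Conn-mono : ∀ {G G'} → G ⊆ G' → ∀ {x y} → Conn G x y → Conn G' x y
  Conn-mono {G} {G'} G⊆G' = Star.map (λ {x} {y} → Adj-mono {G} {G'} G⊆G' {x} {y})

  Conn-sym : ∀ {G x y} → Conn G x y → Conn G y x
  Conn-sym {G} = Star.reverse (λ {x} {y} → Adj-sym {G} x y)

  edge-conn : ∀ {G v e} → G v e ≡ true → Conn G (inj₁ v) (inj₂ e)
  edge-conn h = h ◅ ε

  Adj-cases : ∀ G v e {x y} → Adj G x y →
    Adj (G ─ (v , e)) x y ⊎ (x ≡ inj₁ v × y ≡ inj₂ e) ⊎ (x ≡ inj₂ e × y ≡ inj₁ v)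
  Adj-cases G v e {inj₁ v'} {inj₂ e'} h with (v' , e') ≟ₑ (v , e)
  ... | yes refl = inj₂ (inj₁ (refl , refl))
  ... | no ne = inj₁ (─-kept G v e h ne)
  Adj-cases G v e {inj₂ e'} {inj₁ v'} h with (v' , e') ≟ₑ (v , e)
  ... | yes refl = inj₂ (inj₂ (refl , refl))
  ... | no ne = inj₁ (─-kept G v e h ne)

  Split : Sub → Fin n → Fin m → Node → Node → Set
  Split G v e x y = Conn K x y ⊎ (Conn K x (inj₁ v) × Conn K (inj₂ e) y) ⊎ (Conn K x (inj₂ e) × Conn K (inj₁ v) y)
    where
    K : Sub
    K = G ─ (v , e)

  -- One crossing of `v e` suffices: two in the same direction merge by dropping the detour between
  -- them, and two in opposite directions cancel.
  split : ∀ G v e {x y} → Conn G x y → Split G v e x y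
  split G v e ε = inj₁ ε
  split G v e (a ◅ p) with Adj-cases G v e a | split G v e p
  ... | inj₁ a' | inj₁ q = inj₁ (a' ◅ q)
  ... | inj₁ a' | inj₂ (inj₁ (q , r)) = inj₂ (inj₁ (a' ◅ q , r))
  ... | inj₁ a' | inj₂ (inj₂ (q , r)) = inj₂ (inj₂ (a' ◅ q , r))
  ... | inj₂ (inj₁ (refl , refl)) | inj₁ q = inj₂ (inj₁ (ε , q))
  ... | inj₂ (inj₁ (refl , refl)) | inj₂ (inj₁ (q , r)) = inj₂ (inj₁ (ε , r))
  ... | inj₂ (inj₁ (refl , refl)) | inj₂ (inj₂ (q , r)) = inj₁ r
  ... | inj₂ (inj₂ (refl , refl)) | inj₁ q = inj₂ (inj₂ (ε , q))
  ... | inj₂ (inj₂ (refl , refl)) | inj₂ (inj₁ (q , r)) = inj₁ r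
  ... | inj₂ (inj₂ (refl , refl)) | inj₂ (inj₂ (q , r)) = inj₂ (inj₂ (ε , r))

  Bridge : Sub → Fin n → Fin m → Set
  Bridge T v e = ¬ Conn (T ─ (v , e)) (inj₁ v) (inj₂ e)

  sides : ∀ {T} → Connected T → ∀ v e x →
    Conn (T ─ (v , e)) x (inj₁ v) ⊎ Conn (T ─ (v , e)) x (inj₂ e)
  sides {T} conn v e x with split T v e (conn x (inj₁ v))
  ... | inj₁ q = inj₁ q
  ... | inj₂ (inj₁ (q , _)) = inj₁ q
  ... | inj₂ (inj₂ (q , _)) = inj₂ q

  spanning-⊆ : ∀ {G G' T} → T ⊆ G' → IsSpanningTree G T → IsSpanningTree G' T
  spanning-⊆ T⊆G' (_ , conn , acyc) = T⊆G' , conn , acyc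

  hypertree-mono : ∀ X f {G G'} → G ⊆ G' → IsHypertree X f G → IsHypertree X f G'
  hypertree-mono X f {G} {G'} G⊆G' (T , tree@(T⊆G , _) , real) =
    T , spanning-⊆ {G} {G'} {T} (λ v e → G⊆G' v e ∘ T⊆G v e) tree , real

  -- Read contrapositively: a mandatory edge belongs to every realizing tree.
  hypertree-avoid : ∀ X f {G T v e} → IsSpanningTree G T → Realizes X f T → T v e ≡ false →
    IsHypertree X f (G ─ (v , e))
  hypertree-avoid X f {G} {T} {v} {e} tree@(T⊆G , _) real Tve =
    T , spanning-⊆ {G} {G ─ (v , e)} {T}
      (λ v' e' h → ─-kept G v e (T⊆G v' e' h) λ { refl → contradiction (trans (sym h) Tve) λ () }) tree , real

  -- Deleting `y a` splits the tree into the part of `y` and the part of `a`. As `z` lies in the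
  -- former, `z a` joins the two parts again.
  exchange : ∀ {G T y z a} → IsSpanningTree G T → T y a ≡ true →
    Conn (T ─ (y , a)) (inj₁ z) (inj₁ y) → G z a ≡ true → IsSpanningTree G ((T ─ (y , a)) ∪ₑ (z , a))
  exchange {G} {T} {y} {z} {a} (T⊆G , conn , acyc) Tya z~y Gza = T'⊆G , conn' , acyc'
    where
    K T' : Sub
    K = T ─ (y , a)
    T' = K ∪ₑ (z , a)
    K⊆T' : K ⊆ T'
    K⊆T' = ⊆-∪ₑ K (z , a)
    T'⊆G : T' ⊆ G
    T'⊆G v e h with (v , e) ≟ₑ (z , a)
    ... | yes refl = Gza
    ... | no _ = T⊆G v e (─-⊆ T (y , a) v e h)
    to-a : ∀ x → Conn T' x (inj₂ a)
    to-a x with sides {T} conn y a x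
    ... | inj₁ x~y = Conn-mono {K} {T'} K⊆T' (x~y ◅◅ Conn-sym {K} z~y) ◅◅ edge-conn {T'} (∪ₑ-new K z a)
    ... | inj₂ x~a = Conn-mono {K} {T'} K⊆T' x~a
    conn' : Connected T'
    conn' x x' = to-a x ◅◅ Conn-sym {T'} (to-a x')
    T'─⊆K : (T' ─ (z , a)) ⊆ K
    T'─⊆K v e h = trans (sym (∪ₑ-other K (z , a) {v} {e} (─-≢ T' z a {v} {e} h))) (─-⊆ T' (z , a) v e h)
    acyc' : ∀ v e → T' v e ≡ true → Bridge T' v e
    acyc' v e h p with (v , e) ≟ₑ (z , a)
    ... | yes refl = acyc y a Tya (Conn-sym {K} z~y ◅◅ Conn-mono {T' ─ (z , a)} {K} T'─⊆K p)
    -- A detour around `v e` that avoids `z a` already exists in `T`. One that uses `z a`, in either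
    -- direction, joins `y` to `a` in `K` with the help of `v e`.
    ... | no ne with split (T' ─ (v , e)) z a p
    ...   | inj₁ q = acyc v e (─-⊆ T (y , a) v e h) (Conn-mono {(T' ─ (v , e)) ─ (z , a)} {T ─ (v , e)} sub q)
      where
      sub : ((T' ─ (v , e)) ─ (z , a)) ⊆ (T ─ (v , e))
      sub v' e' h' = ─-mono {K} {T} (v , e) (─-⊆ T (y , a)) v' e'
        (─-kept K v e {v'} {e'} (trans (sym (∪ₑ-other K (z , a) {v'} {e'} (─-≢ (T' ─ (v , e)) z a {v'} {e'} h')))
          (─-⊆ T' (v , e) v' e' h'')) (─-≢ T' v e {v'} {e'} h''))
        where
        h'' : (T' ─ (v , e)) v' e' ≡ true
        h'' = ─-⊆ (T' ─ (v , e)) (z , a) v' e' h'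
    ...   | inj₂ (inj₁ (v~z , a~e)) = acyc y a Tya
      (Conn-sym {K} (inK v~z ◅◅ z~y) ◅◅ edge-conn {K} h ◅◅ Conn-sym {K} (inK a~e))
      where
      inK : ∀ {x x'} → Conn ((T' ─ (v , e)) ─ (z , a)) x x' → Conn K x x'
      inK = Conn-mono {(T' ─ (v , e)) ─ (z , a)} {K} λ v' e' h' →
        T'─⊆K v' e' (─-mono {T' ─ (v , e)} {T'} (z , a) (─-⊆ T' (v , e)) v' e' h')
    ...   | inj₂ (inj₂ (v~a , z~e)) = acyc y a Tya
      (Conn-sym {K} z~y ◅◅ inK z~e ◅◅ Conn-sym {K} (edge-conn {K} h) ◅◅ inK v~a)
      where
      inK : ∀ {x x'} → Conn ((T' ─ (v , e)) ─ (z , a)) x x' → Conn K x x'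
      inK = Conn-mono {(T' ─ (v , e)) ─ (z , a)} {K} λ v' e' h' →
        T'─⊆K v' e' (─-mono {T' ─ (v , e)} {T'} (z , a) (─-⊆ T' (v , e)) v' e' h')

  -- Both edges of the exchange end at `a`, so emerald degrees elsewhere are untouched and the
  -- degree of `a` loses one and gains one. The edge `z a` is new, since otherwise `y a` would not
  -- be a bridge.
  exchange-realizes : ∀ {T y z a f} → (∀ v e → T v e ≡ true → Bridge T v e) → T y a ≡ true →
    Conn (T ─ (y , a)) (inj₁ z) (inj₁ y) → Realizes emerald f T →
    Realizes emerald f ((T ─ (y , a)) ∪ₑ (z , a))
  exchange-realizes {T} {y} {z} {a} acyc Tya z~y real e with e ≟ᶠ a
  ... | no e≢a = trans (count-cong λ v → trans (∪ₑ-other (T ─ (y , a)) (z , a) {v} {e} (e≢a ∘ cong proj₂))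
      (─-other T y a {v} {e} (e≢a ∘ cong proj₂))) (real e)
  ... | yes refl = trans degT' (trans (sym degT) (real a))
    where
    K : Sub
    K = T ─ (y , a)
    Kza : K z a ≡ false
    Kza with K z a in eq
    ... | false = refl
    ... | true = contradiction (Conn-sym {K} z~y ◅◅ edge-conn {K} eq) (acyc y a Tya)
    degT : degE T a ≡ suc (degE K a)
    degT = count-insert y (─-removed T y a) Tya λ v v≢y → sym (─-other T y a (v≢y ∘ cong proj₁))
    degT' : degE (K ∪ₑ (z , a)) a ≡ suc (degE K a)
    degT' = count-insert z Kza (∪ₑ-new K z a) λ v v≢z → ∪ₑ-other K (z , a) (v≢z ∘ cong proj₁)

  -- Deciding the hypertree condition

  -- By recursion on a list containing all edges of the graph: `split` reduces reachability to the
  -- graph without the first listed edge.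
  conn?-within : ∀ (es : List Edge) G → (∀ v e → G v e ≡ true → (v , e) ∈ es) → ∀ x y → Dec (Conn G x y)
  conn?-within [] G G⊆[] x y = mapDec (λ { refl → ε }) trivial (x ≟ₙ y)
    where
    trivial : ∀ {x y} → Conn G x y → x ≡ y
    trivial ε = refl
    trivial {inj₁ v} (_◅_ {j = inj₂ e} a p) with G⊆[] v e a
    ... | ()
    trivial {inj₂ e} (_◅_ {j = inj₁ v} a p) with G⊆[] v e a
    ... | ()
  conn?-within ((v , e) ∷ es) G G⊆es x y = decide (G v e Bool.≟ true)
    where
    K : Sub
    K = G ─ (v , e)
    K⊆es : ∀ v' e' → K v' e' ≡ true → (v' , e') ∈ es
    K⊆es v' e' h with G⊆es v' e' (─-⊆ G (v , e) v' e' h)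
    ... | here eq = contradiction eq (─-≢ G v e h)
    ... | there i = i
    K? : ∀ x y → Dec (Conn K x y)
    K? = conn?-within es K K⊆es
    up : ∀ {x y} → Conn K x y → Conn G x y
    up = Conn-mono {K} {G} (─-⊆ G (v , e))
    decide : Dec (G v e ≡ true) → Dec (Conn G x y)
    decide (no ¬Gve) = mapDec up (Conn-mono {G} {K} λ v' e' h → ─-kept G v e h λ { refl → ¬Gve h }) (K? x y)
    decide (yes Gve) = mapDec join (split G v e)
      (K? x y ⊎-dec ((K? x (inj₁ v) ×-dec K? (inj₂ e) y) ⊎-dec (K? x (inj₂ e) ×-dec K? (inj₁ v) y)))
      where
      join : Split G v e x y → Conn G x y
      join (inj₁ q) = up q
      join (inj₂ (inj₁ (q , r))) = up q ◅◅ edge-conn {G} Gve ◅◅ up r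
      join (inj₂ (inj₂ (q , r))) = up q ◅◅ Conn-sym {G} (edge-conn {G} Gve) ◅◅ up r

  conn? : ∀ G x y → Dec (Conn G x y)
  conn? G = conn?-within (cartesianProduct (allFin n) (allFin m)) G
    λ v e _ → ∈-cartesianProduct⁺ (∈-allFin v) (∈-allFin e)

  connected? : ∀ G → Dec (Connected G)
  connected? G = mapDec (λ { (vv , ve , ev , ee) → λ
      { (inj₁ v) (inj₁ v') → vv v v' ; (inj₁ v) (inj₂ e) → ve v e
      ; (inj₂ e) (inj₁ v) → ev e v ; (inj₂ e) (inj₂ e') → ee e e' } })
    (λ c → (λ v v' → c (inj₁ v) (inj₁ v')) , (λ v e → c (inj₁ v) (inj₂ e)) ,
           (λ e v → c (inj₂ e) (inj₁ v)) , (λ e e' → c (inj₂ e) (inj₂ e')))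
    ((all? λ v → all? λ v' → conn? G (inj₁ v) (inj₁ v')) ×-dec
     (all? λ v → all? λ e → conn? G (inj₁ v) (inj₂ e)) ×-dec
     (all? λ e → all? λ v → conn? G (inj₂ e) (inj₁ v)) ×-dec
     (all? λ e → all? λ e' → conn? G (inj₂ e) (inj₂ e')))

  spanningTree? : ∀ G T → Dec (IsSpanningTree G T)
  spanningTree? G T =
    (all? λ v → all? λ e → (T v e Bool.≟ true) →-dec (G v e Bool.≟ true)) ×-dec
    connected? T ×-dec
    (all? λ v → all? λ e → (T v e Bool.≟ true) →-dec ¬? (conn? (T ─ (v , e)) (inj₁ v) (inj₂ e)))

  realizes? : ∀ X f T → Dec (Realizes X f T)
  realizes? violet f T = all? λ v → degV T v ℕ.≟ suc (f v)
  realizes? emerald f T = all? λ e → degE T e ℕ.≟ suc (f e)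

  spanningTree-resp : ∀ {G T T'} → (∀ v e → T v e ≡ T' v e) → IsSpanningTree G T → IsSpanningTree G T'
  spanningTree-resp {G} {T} {T'} T≗T' (T⊆G , conn , acyc) =
    (λ v e h → T⊆G v e (T'⊆T v e h)) , (λ x y → Conn-mono {T} {T'} T⊆T' (conn x y)) ,
    λ v e h p → acyc v e (T'⊆T v e h) (Conn-mono {T' ─ (v , e)} {T ─ (v , e)} (─-mono {T'} {T} (v , e) T'⊆T) p)
    where
    T⊆T' : T ⊆ T'
    T⊆T' v e h = trans (sym (T≗T' v e)) h
    T'⊆T : T' ⊆ T
    T'⊆T v e h = trans (T≗T' v e) h

  realizes-resp : ∀ X f {T T'} → (∀ v e → T v e ≡ T' v e) → Realizes X f T → Realizes X f T'
  realizes-resp violet f T≗T' real v = trans (sym (count-cong (T≗T' v))) (real v)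
  realizes-resp emerald f T≗T' real e = trans (sym (count-cong λ v → T≗T' v e)) (real e)

  -- The process branches on this condition. Candidate trees are enumerated as subsets of the
  -- `n * m` edge positions; decoding recovers a tree only pointwise, hence `spanningTree-resp` and
  -- `realizes-resp`.
  hypertree? : ∀ X f G → Dec (IsHypertree X f G)
  hypertree? X f G = mapDec (λ { (s , t , r) → decode s , t , r }) encode
      (anySubset? λ s → spanningTree? G (decode s) ×-dec realizes? X f (decode s))
    where
    decode : Subset (n * m) → Sub
    decode s v e = Vec.lookup s (combine v e)
    encode : IsHypertree X f G → ∃ λ s → IsSpanningTree G (decode s) × Realizes X f (decode s)
    encode (T , t , r) = code , spanningTree-resp {G} {T} T≗ t , realizes-resp X f {T} T≗ r
      where
      code : Subset (n * m)
      code = Vec.tabulate (uncurry T ∘ remQuot m)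
      T≗ : ∀ v e → T v e ≡ decode code v e
      T≗ v e = sym (trans (lookup∘tabulate _ (combine v e)) (cong (uncurry T) (remQuot-combine v e)))

  -- The exchange argument against mandatory cycles

  -- The step after the last visit of a path to its start a.
  last-exit : ∀ G {a z} → z ≢ inj₂ a → Conn G (inj₂ a) z →
    ∃ λ y → G y a ≡ true × Conn (G ─ (y , a)) (inj₁ y) z
  last-exit G {a} {z} z≢a p with exit-or-avoid p
    where
    Exit : Set
    Exit = ∃ λ y → G y a ≡ true × Conn (G ─ (y , a)) (inj₁ y) z
    exit-or-avoid : ∀ {x} → Conn G x z → Exit ⊎ (x ≢ inj₂ a × (∀ y → Conn (G ─ (y , a)) x z))
    exit-or-avoid ε = inj₂ (z≢a , λ y → ε)
    exit-or-avoid {x} (_◅_ {j = x'} s q) with exit-or-avoid q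
    ... | inj₁ ex = inj₁ ex
    ... | inj₂ (x'≢a , q') with x ≟ₙ inj₂ a
    exit-or-avoid (_◅_ {j = inj₁ y} s q) | inj₂ (_ , q') | yes refl = inj₁ (y , s , q' y)
    ... | no x≢a = inj₂ (x≢a , λ y → avoid y (Adj-cases G y a s))
      where
      avoid : ∀ y → Adj (G ─ (y , a)) x x' ⊎ (x ≡ inj₁ y × x' ≡ inj₂ a) ⊎ (x ≡ inj₂ a × x' ≡ inj₁ y) →
        Conn (G ─ (y , a)) x z
      avoid y (inj₁ s') = s' ◅ q' y
      avoid y (inj₂ (inj₁ (_ , eq))) = contradiction eq x'≢a
      avoid y (inj₂ (inj₂ (eq , _))) = contradiction eq x≢a
  ... | inj₁ ex = ex
  ... | inj₂ (a≢a , _) = contradiction refl a≢a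

  -- The cycle is w 0 → a 0 → w 1 → a 1 → … → a k → w 0.  A realizing tree in which some step
  -- a j → w (suc j) crosses the cut of w 0 a 0 yields, by an exchange at a j, another one in which
  -- an earlier step does; in the end the exchange at a 0 removes the mandatory edge w 0 a 0.
  module NoCycle (f : Weight emerald) (G : Sub) (k : ℕ) (w : ℕ → Fin n) (a : ℕ → Fin m)
    (mand : ∀ i → i ≤ k → ¬ IsHypertree emerald f (G ─ (w i , a i)))
    (edge : ∀ i → i ≤ k → G (w (suc i)) (a i) ≡ true)
    (w-step : ∀ i → i ≤ k → w i ≢ w (suc i))
    (a-inj : ∀ i j → i < j → j ≤ k → a i ≢ a j)
    (close : w (suc k) ≡ w 0)
    where

    w₀ a₀ : Node
    w₀ = inj₁ (w 0)
    a₀ = inj₂ (a 0)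

    cut₀ : Sub → Sub
    cut₀ T = T ─ (w 0 , a 0)

    mand∈ : ∀ {T} → IsSpanningTree G T → Realizes emerald f T → ∀ i → i ≤ k → T (w i) (a i) ≡ true
    mand∈ {T} tree real i i≤k with T (w i) (a i) in eq
    ... | true = refl
    ... | false = contradiction (hypertree-avoid emerald f {G} {T} tree real eq) (mand i i≤k)

    -- The exchange would produce a realizing tree that misses the mandatory edge `w i a i`.
    swapped-out : ∀ {T y z} i → i ≤ k → y ≡ w i → z ≢ w i → IsSpanningTree G T → Realizes emerald f T →
      T y (a i) ≡ true → Conn (T ─ (y , a i)) (inj₁ z) (inj₁ y) → G z (a i) ≡ true → ⊥
    swapped-out {T} {z = z} i i≤k refl z≢w tree real Tya z~y Gza =
      mand i i≤k (hypertree-avoid emerald f {G} {K ∪ₑ (z , a i)} (exchange {G} {T} tree Tya z~y Gza)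
        (exchange-realizes {T} {f = f} (proj₂ (proj₂ tree)) Tya z~y real)
        (trans (∪ₑ-other K (z , a i) {w i} {a i} (z≢w ∘ sym ∘ cong proj₁)) (─-removed T (w i) (a i))))
      where
      K : Sub
      K = T ─ (w i , a i)

    Crossing : ℕ → Set
    Crossing j = ∃ λ T → IsSpanningTree G T × Realizes emerald f T ×
      Conn (cut₀ T) (inj₂ (a j)) a₀ × Conn (cut₀ T) (inj₁ (w (suc j))) w₀

    no-crossing : ∀ j → j ≤ k → ¬ Crossing j
    no-crossing = <-rec (λ j → j ≤ k → ¬ Crossing j) step
      where
      step : ∀ j → (∀ {i} → i < j → i ≤ k → ¬ Crossing i) → j ≤ k → ¬ Crossing j
      step zero rec _ (T , tree , real , _ , w₁~w₀) =
        swapped-out {T} 0 z≤n refl (w-step 0 z≤n ∘ sym) tree real (mand∈ {T} tree real 0 z≤n) w₁~w₀ (edge 0 z≤n)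
      step j@(suc _) rec j≤k (T , tree@(T⊆G , conn , acyc) , real , aj~a₀ , wj⁺~w₀)
        with last-exit (cut₀ T) {a j} {a₀} (a-inj 0 j z<s j≤k ∘ inj₂-injective) aj~a₀
      -- `y` is the next node on the way from `a j` to `a 0`. Trading `y a j` for `w (suc j) a j`
      -- moves the part of `a j` to the side of `w 0`; an earlier crossing is then sought in `T` or
      -- in `T'`.
      ... | y , Tya' , y~a₀ = scan _ 0 (ℕ.+-comm _ 1) ε
        where
        K Ky T' : Sub
        K = cut₀ T ─ (y , a j)
        Ky = T ─ (y , a j)
        T' = Ky ∪ₑ (w (suc j) , a j)
        Tya : T y (a j) ≡ true
        Tya = ─-⊆ T (w 0 , a 0) y (a j) Tya'
        a₀≢aj : a 0 ≢ a j
        a₀≢aj = a-inj 0 j z<s j≤k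
        K⊆cut : K ⊆ cut₀ T
        K⊆cut = ─-⊆ (cut₀ T) (y , a j)
        K⊆Ky : K ⊆ Ky
        K⊆Ky = ─-mono {cut₀ T} {T} (y , a j) (─-⊆ T (w 0 , a 0))
        bridge₀ : ¬ Conn (cut₀ T) w₀ a₀
        bridge₀ = acyc (w 0) (a 0) (mand∈ {T} tree real 0 z≤n)
        K⇒cut : ∀ {x x'} → Conn K x x' → Conn (cut₀ T) x x'
        K⇒cut = Conn-mono {K} {cut₀ T} K⊆cut
        K⇒Ky : ∀ {x x'} → Conn K x x' → Conn Ky x x'
        K⇒Ky = Conn-mono {K} {Ky} K⊆Ky
        -- The edge `y a j` lies on the side of `a 0`, so a path on the side of `w 0` cannot use it.
        wj⁺~w₀ᴷ : Conn K (inj₁ (w (suc j))) w₀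
        wj⁺~w₀ᴷ with split (cut₀ T) y (a j) wj⁺~w₀
        ... | inj₁ p = p
        ... | inj₂ (inj₁ (_ , aj~w₀)) = contradiction (Conn-sym {cut₀ T} (K⇒cut aj~w₀) ◅◅ aj~a₀) bridge₀
        ... | inj₂ (inj₂ (_ , y~w₀)) = contradiction (Conn-sym {cut₀ T} (K⇒cut y~w₀) ◅◅ K⇒cut y~a₀) bridge₀
        wj⁺~y : Conn Ky (inj₁ (w (suc j))) (inj₁ y)
        wj⁺~y = K⇒Ky wj⁺~w₀ᴷ ◅◅
          edge-conn {Ky} (─-kept T y (a j) {w 0} {a 0} (mand∈ {T} tree real 0 z≤n) (a₀≢aj ∘ cong proj₂)) ◅◅
          K⇒Ky (Conn-sym {K} y~a₀)
        y≢wj : y ≢ w j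
        y≢wj y≡wj = swapped-out {T} j j≤k y≡wj (w-step j j≤k ∘ sym) tree real Tya wj⁺~y (edge j j≤k)
        tree' : IsSpanningTree G T'
        tree' = exchange {G} {T} tree Tya wj⁺~y (edge j j≤k)
        real' : Realizes emerald f T'
        real' = exchange-realizes {T} {f = f} acyc Tya wj⁺~y real
        K⊆cut' : K ⊆ cut₀ T'
        K⊆cut' v e h = ─-kept T' (w 0) (a 0) (⊆-∪ₑ Ky (w (suc j) , a j) v e (K⊆Ky v e h))
          (─-≢ T (w 0) (a 0) {v} {e} (K⊆cut v e h))
        K⇒cut' : ∀ {x x'} → Conn K x x' → Conn (cut₀ T') x x'
        K⇒cut' = Conn-mono {K} {cut₀ T'} K⊆cut'
        aj~wj⁺' : Conn (cut₀ T') (inj₂ (a j)) (inj₁ (w (suc j)))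
        aj~wj⁺' = Conn-sym {cut₀ T'} (edge-conn {cut₀ T'}
          (─-kept T' (w 0) (a 0) {w (suc j)} {a j} (∪ₑ-new Ky (w (suc j)) (a j)) (a₀≢aj ∘ sym ∘ cong proj₂)))
        -- Without `w 0 a 0` and `y a j` the tree falls into the parts of `w 0`, of `a j` and of
        -- `a 0`.
        parts : ∀ x → Conn K x w₀ ⊎ Conn K x (inj₂ (a j)) ⊎ Conn K x a₀
        parts x with sides {T} conn (w 0) (a 0) x
        ... | inj₁ p with split (cut₀ T) y (a j) p
        ...   | inj₁ q = inj₁ q
        ...   | inj₂ (inj₁ (q , _)) = inj₂ (inj₂ (q ◅◅ y~a₀))
        ...   | inj₂ (inj₂ (q , _)) = inj₂ (inj₁ q)
        parts x | inj₂ p with split (cut₀ T) y (a j) p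
        ...   | inj₁ q = inj₂ (inj₂ q)
        ...   | inj₂ (inj₁ (q , _)) = inj₂ (inj₂ (q ◅◅ y~a₀))
        ...   | inj₂ (inj₂ (q , _)) = inj₂ (inj₁ q)
        -- Follows the cycle from `a 0` while it stays in the part of `a 0`. Leaving for the part of
        -- `w 0` is a crossing at `i` in `T`; leaving for the part of `a j` is one in `T'`.
        scan : ∀ r i → r + suc i ≡ j → Conn K (inj₂ (a i)) a₀ → ⊥
        scan r i r+i≡j ai~a₀ with parts (inj₁ (w (suc i)))
          | (i < j) ∋ ℕ.≤-trans (ℕ.m≤n+m (suc i) r) (ℕ.≤-reflexive r+i≡j)
        ... | inj₁ wi⁺~w₀ | i<j = rec i<j (ℕ.<⇒≤ (ℕ.<-≤-trans i<j j≤k)) (T , tree , real , K⇒cut ai~a₀ , K⇒cut wi⁺~w₀)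
        ... | inj₂ (inj₁ wi⁺~aj) | i<j = rec i<j (ℕ.<⇒≤ (ℕ.<-≤-trans i<j j≤k))
          (T' , tree' , real' , K⇒cut' ai~a₀ , K⇒cut' wi⁺~aj ◅◅ aj~wj⁺' ◅◅ K⇒cut' wj⁺~w₀ᴷ)
        -- Here `w (suc i)` is `w j`. The mandatory edge `w j a j`, distinct from `y a j`, joins
        -- `a j` to the part of `a 0`, so `y a j` would not be a bridge.
        scan zero i refl ai~a₀ | inj₂ (inj₂ wi⁺~a₀) | i<j =
          acyc y (a j) Tya (K⇒Ky (y~a₀ ◅◅ Conn-sym {K} wi⁺~a₀ ◅◅ edge-conn {K} wjajᴷ))
          where
          wjajᴷ : K (w j) (a j) ≡ true
          wjajᴷ = ─-kept (cut₀ T) y (a j) {w j} {a j}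
            (─-kept T (w 0) (a 0) {w j} {a j} (mand∈ {T} tree real j j≤k) (a₀≢aj ∘ sym ∘ cong proj₂))
            (y≢wj ∘ sym ∘ cong proj₁)
        scan (suc r) i r+i≡j ai~a₀ | inj₂ (inj₂ wi⁺~a₀) | i<j =
          scan r (suc i) r+i⁺≡j (Conn-sym {K} (edge-conn {K} wi⁺ai⁺ᴷ) ◅◅ wi⁺~a₀)
          where
          r+i⁺≡j : r + suc (suc i) ≡ j
          r+i⁺≡j = trans (ℕ.+-suc r (suc i)) r+i≡j
          i⁺<j : suc i < j
          i⁺<j = ℕ.≤-trans (ℕ.m≤n+m (suc (suc i)) r) (ℕ.≤-reflexive r+i⁺≡j)
          i⁺≤k : suc i ≤ k
          i⁺≤k = ℕ.<⇒≤ (ℕ.<-≤-trans i⁺<j j≤k)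
          wi⁺ai⁺ᴷ : K (w (suc i)) (a (suc i)) ≡ true
          wi⁺ai⁺ᴷ = ─-kept (cut₀ T) y (a j) {w (suc i)} {a (suc i)}
            (─-kept T (w 0) (a 0) {w (suc i)} {a (suc i)} (mand∈ {T} tree real (suc i) i⁺≤k)
              (a-inj 0 (suc i) z<s i⁺≤k ∘ sym ∘ cong proj₂))
            (a-inj (suc i) j i⁺<j j≤k ∘ cong proj₂)

    -- Going around from `a 0`, the first step to change sides is a crossing. If none does,
    -- `w (suc k)`, which is `w 0`, ends up on the side of `a 0`.
    no-cycle : ¬ IsHypertree emerald f G
    no-cycle (T , tree@(_ , conn , acyc) , real) = walk k 0 (ℕ.+-identityʳ k) ε
      where
      bridge₀ : ¬ Conn (cut₀ T) w₀ a₀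
      bridge₀ = acyc (w 0) (a 0) (mand∈ {T} tree real 0 z≤n)
      walk : ∀ r i → r + i ≡ k → Conn (cut₀ T) (inj₂ (a i)) a₀ → ⊥
      walk r i r+i≡k ai~a₀ with sides {T} conn (w 0) (a 0) (inj₁ (w (suc i)))
      ... | inj₁ wi⁺~w₀ = no-crossing i (subst (i ≤_) r+i≡k (ℕ.m≤n+m i r)) (T , tree , real , ai~a₀ , wi⁺~w₀)
      walk zero i refl ai~a₀ | inj₂ wi⁺~a₀ = bridge₀ (subst (λ v → Conn (cut₀ T) (inj₁ v) a₀) close wi⁺~a₀)
      walk (suc r) i r+i≡k ai~a₀ | inj₂ wi⁺~a₀ = walk r (suc i) r+i⁺≡k
          (Conn-sym {cut₀ T} (edge-conn {cut₀ T} wi⁺ai⁺) ◅◅ wi⁺~a₀)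
        where
        r+i⁺≡k : r + suc i ≡ k
        r+i⁺≡k = trans (ℕ.+-suc r i) r+i≡k
        i⁺≤k : suc i ≤ k
        i⁺≤k = subst (suc i ≤_) r+i⁺≡k (ℕ.m≤n+m (suc i) r)
        wi⁺ai⁺ : cut₀ T (w (suc i)) (a (suc i)) ≡ true
        wi⁺ai⁺ = ─-kept T (w 0) (a 0) {w (suc i)} {a (suc i)} (mand∈ {T} tree real (suc i) i⁺≤k)
          (a-inj 0 (suc i) z<s i⁺≤k ∘ sym ∘ cong proj₂)

-- Cycles through mandatory edges

data Directed {n m : ℕ} (Out : Fin n → Fin m → Set) (In : Fin m → Fin n → Set) : Fin n ⊎ Fin m → Fin n ⊎ Fin m → Set where
  out : ∀ {v e} → Out v e → Directed Out In (inj₁ v) (inj₂ e)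
  in′ : ∀ {v e} → In e v → Directed Out In (inj₂ e) (inj₁ v)

module LoopErasure {n m : ℕ} (Out : Fin n → Fin m → Set) (In : Fin m → Fin n → Set) (w₀ : Fin n) where

  -- Directed paths to w₀ without repeated emerald nodes and immediate reversals, indexed
  -- by their first emerald node, their first violet node and the list of emerald nodes.
  data Path : Fin m → Fin n → List (Fin m) → Set where
    end : ∀ {a} → In a w₀ → Path a w₀ [ a ]
    step : ∀ {a w a' w' as} → In a w → Out w a' → Path a' w' as → w ≢ w' → a ∉ as → Path a w (a ∷ as)

  Path-from : Fin m → Set
  Path-from a = ∃ λ w → ∃ λ as → Path a w as

  suffix : ∀ {a b w as} → b ∈ as → Path a w as → Path-from b
  suffix (here refl) p@(end _) = _ , _ , p
  suffix (here refl) p@(step _ _ _ _ _) = _ , _ , p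
  suffix (there b∈) (step _ _ p _ _) = suffix b∈ p

  -- If `a` recurs, the path restarts at that occurrence. If `w` is `w'`, the reversal through `a'`
  -- is cut out, and the path leaves `w` by its next step or ends there.
  extend : ∀ {a w a' w' as} → In a w → Out w a' → Path a' w' as → Path-from a
  extend {a} {w} {w' = w'} {as} i o p with DecMembership._∈?_ _≟ᶠ_ a as | w ≟ᶠ w'
  ... | yes a∈ | _ = suffix a∈ p
  ... | no a∉ | no w≢w' = _ , _ , step i o p w≢w' a∉
  extend i o (end _) | no _ | yes refl = _ , _ , end i
  extend i o (step _ o' p w≢ _) | no a∉ | yes refl = _ , _ , step i o' p w≢ (a∉ ∘ there)

  erase : ∀ {a} → Star (Directed Out In) (inj₂ a) (inj₁ w₀) → Path-from a
  erase (in′ i ◅ ε) = _ , _ , end i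
  erase (in′ i ◅ out o ◅ p) = extend i o (proj₂ (proj₂ (erase p)))

  len : ∀ {a w as} → Path a w as → ℕ
  len (end _) = 0
  len (step _ _ p _ _) = suc (len p)

  -- Values beyond index `len p`, here and in `violets`, are fillers; the cycle built from them uses
  -- indices up to `len p`.
  emeralds : ∀ {a w as} → Path a w as → ℕ → Fin m
  emeralds {a} (end _) _ = a
  emeralds {a} (step _ _ _ _ _) zero = a
  emeralds (step _ _ p _ _) (suc i) = emeralds p i

  violets : ∀ {a w as} → Path a w as → ℕ → Fin n
  violets (end _) _ = w₀
  violets {w = w} (step _ _ _ _ _) zero = w
  violets (step _ _ p _ _) (suc i) = violets p i

  emeralds-0 : ∀ {a w as} (p : Path a w as) → emeralds p 0 ≡ a
  emeralds-0 (end _) = refl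
  emeralds-0 (step _ _ _ _ _) = refl

  violets-0 : ∀ {a w as} (p : Path a w as) → violets p 0 ≡ w
  violets-0 (end _) = refl
  violets-0 (step _ _ _ _ _) = refl

  violets-len : ∀ {a w as} (p : Path a w as) → violets p (len p) ≡ w₀
  violets-len (end _) = refl
  violets-len (step _ _ p _ _) = violets-len p

  emeralds-∈ : ∀ {a w as} (p : Path a w as) i → emeralds p i ∈ as
  emeralds-∈ (end _) i = here refl
  emeralds-∈ (step _ _ _ _ _) zero = here refl
  emeralds-∈ (step _ _ p _ _) (suc i) = there (emeralds-∈ p i)

  emeralds-distinct : ∀ {a w as} (p : Path a w as) i j → i < j → j ≤ len p → emeralds p i ≢ emeralds p j
  emeralds-distinct (step _ _ p _ a∉) zero (suc j) _ _ eq = a∉ (subst (_∈ _) (sym eq) (emeralds-∈ p j))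
  emeralds-distinct (step _ _ p _ _) (suc i) (suc j) (s≤s i<j) (s≤s j≤) = emeralds-distinct p i j i<j j≤

  path-in : ∀ {a w as} (p : Path a w as) i → i ≤ len p → In (emeralds p i) (violets p i)
  path-in (end i) _ _ = i
  path-in (step i _ _ _ _) zero _ = i
  path-in (step _ _ p _ _) (suc i) (s≤s i≤) = path-in p i i≤

  path-out : ∀ {a w as} (p : Path a w as) i → i < len p → Out (violets p i) (emeralds p (suc i))
  path-out (step {w = w} _ o p _ _) zero _ = subst (Out w) (sym (emeralds-0 p)) o
  path-out (step _ _ p _ _) (suc i) (s≤s i<) = path-out p i i<

  violets-step : ∀ {a w as} (p : Path a w as) i → i < len p → violets p i ≢ violets p (suc i)
  violets-step (step _ _ p w≢ _) zero _ eq = w≢ (trans eq (violets-0 p))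
  violets-step (step _ _ p _ _) (suc i) (s≤s i<) = violets-step p i i<

module _ {n m : ℕ} (H : Fin m → Fin n → Bool) where
  open Bip H
  open Graph H

  -- Loop erasure of the way back leaves two cases: either it goes from `e` straight to `v`, which
  -- is the claim, or together with `v e` it forms a cycle excluded by `NoCycle`.
  no-one-wayᴱ : ∀ (f : Weight emerald) {G} → IsHypertree emerald f G →
    (Out : Fin n → Fin m → Set) (In : Fin m → Fin n → Set) →
    (∀ v e → Out v e → ¬ IsHypertree emerald f (G ─ (v , e))) → (∀ e v → In e v → G v e ≡ true) →
    ∀ v e → Out v e → Star (Directed Out In) (inj₂ e) (inj₁ v) → In e v
  no-one-wayᴱ f {G} hyp Out In mand In⊆G v e o back with LoopErasure.erase Out In v back
  ... | w₁ , as , p with w₁ ≟ᶠ v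
  ... | yes refl = normalised (path-in p 0 z≤n)
    where
    open LoopErasure Out In v
    normalised : In (emeralds p 0) (violets p 0) → In e v
    normalised rewrite emeralds-0 p | violets-0 p = λ i → i
  ... | no w₁≢v = contradiction hyp
      (NoCycle.no-cycle f G (len p) w (emeralds p) mand' (λ i i≤ → In⊆G _ _ (path-in p i i≤)) w-step
        (emeralds-distinct p) (violets-len p))
    where
    open LoopErasure Out In v
    -- `violets p i` is entered after `emeralds p i`, hence the shift by one, with `v` in front.
    w : ℕ → Fin n
    w zero = v
    w (suc i) = violets p i
    outs : ∀ i → i ≤ len p → Out (w i) (emeralds p i)
    outs zero _ = subst (Out v) (sym (emeralds-0 p)) o
    outs (suc i) i< = path-out p i i<
    mand' : ∀ i → i ≤ len p → ¬ IsHypertree emerald f (G ─ (w i , emeralds p i))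
    mand' i i≤ = mand _ _ (outs i i≤)
    w-step : ∀ i → i ≤ len p → w i ≢ w (suc i)
    w-step zero _ eq = w₁≢v (trans (sym (violets-0 p)) (sym eq))
    w-step (suc i) i< = violets-step p i i<

-- Exchanging the two colours

module Transpose {n m : ℕ} (H : Fin m → Fin n → Bool) where
  open Bip H
  open Graph H
  module Bᵗ = Bip (flip H)
  module Gᵗ = Graph (flip H)

  Adj-flip : ∀ G x y → Adj G x y → Bᵗ.Adj (flip G) (swap x) (swap y)
  Adj-flip G (inj₁ _) (inj₂ _) h = h
  Adj-flip G (inj₂ _) (inj₁ _) h = h

  Conn-flip : ∀ G {x y} → Conn G x y → Gᵗ.Conn (flip G) (swap x) (swap y)
  Conn-flip G = gmap swap (λ {x} {y} → Adj-flip G x y)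

  flip-─ : ∀ G v e → flip (flip G Bᵗ.─ (e , v)) ⊆ (G ─ (v , e))
  flip-─ G v e v' e' h = ─-kept G v e (Gᵗ.─-⊆ (flip G) (e , v) e' v' h)
    λ { refl → Gᵗ.─-≢ (flip G) e v h refl }

module _ {n m : ℕ} (H : Fin m → Fin n → Bool) where
  open Bip H
  open Graph H
  open Transpose H
  module Back = Transpose (flip H)

  spanningTree-flip : ∀ {G T} → IsSpanningTree G T → Bᵗ.IsSpanningTree (flip G) (flip T)
  spanningTree-flip {G} {T} (T⊆G , conn , acyc) = (λ e v → T⊆G v e) , conn' ,
    λ e v h p → acyc v e h (Conn-sym {T ─ (v , e)} (Conn-mono {flip (flip T Bᵗ.─ (e , v))} {T ─ (v , e)}
      (flip-─ T v e) (Back.Conn-flip (flip T Bᵗ.─ (e , v)) p)))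
    where
    conn' : Bᵗ.Connected (flip T)
    conn' (inj₁ x) (inj₁ y) = Conn-flip T (conn (inj₂ x) (inj₂ y))
    conn' (inj₁ x) (inj₂ y) = Conn-flip T (conn (inj₂ x) (inj₁ y))
    conn' (inj₂ x) (inj₁ y) = Conn-flip T (conn (inj₁ x) (inj₂ y))
    conn' (inj₂ x) (inj₂ y) = Conn-flip T (conn (inj₁ x) (inj₁ y))

module _ {n m : ℕ} (H : Fin m → Fin n → Bool) where
  open Bip H
  open Graph H
  open Transpose H using (module Bᵗ; flip-─)

  -- For X = violet, exchange the colours and reverse all directions: mandatory edges are still
  -- directed from violet to emerald.
  no-one-way : ∀ X (f : Weight X) {G} → IsHypertree X f G →
    (Out : Fin n → Fin m → Set) (In : Fin m → Fin n → Set) →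
    (∀ v e → Out v e → ¬ IsHypertree X f (G ─ (v , e))) → (∀ e v → In e v → G v e ≡ true) →
    ∀ v e → Out v e → Star (Directed Out In) (inj₂ e) (inj₁ v) → In e v
  no-one-way emerald f = no-one-wayᴱ H f
  no-one-way violet f {G} (T , tree , real) Out In mand In⊆G v e o back =
    no-one-wayᴱ (flip H) f (flip T , spanningTree-flip H {G} {T} tree , real) (flip Out) (flip In)
      (λ e v o' → mand v e o' ∘ untranspose v e) (λ v e → In⊆G e v) e v o
      (gmap swap transposed (Star.reverse id back))
    where
    untranspose : ∀ v e → Bᵗ.IsHypertree emerald f (flip G Bᵗ.─ (e , v)) → IsHypertree violet f (G ─ (v , e))
    untranspose v e (T' , tree' , real') = hypertree-mono violet f {flip G'} {G ─ (v , e)} (flip-─ G v e)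
        (flip T' , spanningTree-flip (flip H) {G'} {T'} tree' , real')
      where G' = flip G Bᵗ.─ (e , v)
    transposed : ∀ {x y} → flip (Directed Out In) x y → Directed (flip Out) (flip In) (swap x) (swap y)
    transposed (out o) = out o
    transposed (in′ i) = in′ i

-- Face walks and the process

module _ {a} {A : Set a} where

  lookup-injective : ∀ {xs : List A} → Unique xs → ∀ i j → lookup xs i ≡ lookup xs j → i ≡ j
  lookup-injective (x≢ ∷ u) zero zero eq = refl
  lookup-injective (x≢ ∷ u) zero (suc j) eq = contradiction eq (All.lookup x≢ (∈-lookup j))
  lookup-injective (x≢ ∷ u) (suc i) zero eq = contradiction (sym eq) (All.lookup x≢ (∈-lookup i))
  lookup-injective (x≢ ∷ u) (suc i) (suc j) eq = cong suc (lookup-injective u i j eq)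

  linked-prefix : ∀ {ℓ} {R : A → A → Set ℓ} xs {ys} → Linked R (xs ++ ys) → Linked R xs
  linked-prefix [] _ = []
  linked-prefix (x ∷ []) _ = [-]
  linked-prefix (x ∷ x' ∷ xs) (r ∷ rs) = r ∷ linked-prefix (x' ∷ xs) rs

  linked-truncate : ∀ {ℓ} {R : A → A → Set ℓ} xs {y ys} → Linked R (xs ++ y ∷ ys) → Linked R (xs ∷ʳ y)
  linked-truncate {R = R} xs {y} {ys} rs = linked-prefix (xs ∷ʳ y) (subst (Linked R) (sym (++-assoc xs [ y ] ys)) rs)

module _ {n m : ℕ} {H : Fin m → Fin n → Bool} (ρ : Bip.Ribbon H) (X : Color) (f : Bip.Weight H X) where
  open Bip H
  open Graph H
  open Process ρ X f
  open Ribbon ρ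

  _≟ₜ_ : DecidableEquality Trav
  _≟ₜ_ = ×-≡-dec _≟ᶠ_ (×-≡-dec _≟ᶠ_ _≟ₛ_)
    where
    _≟ₛ_ : DecidableEquality Side
    fromV ≟ₛ fromV = yes refl
    fromV ≟ₛ fromE = no λ ()
    fromE ≟ₛ fromV = no λ ()
    fromE ≟ₛ fromE = yes refl

  -- The face permutation of the ribbon graph `G`, acting on its directed edges.
  φ : Sub → Trav → Trav
  φ G (v , e , fromV) = succE G e v , e , fromE
  φ G (v , e , fromE) = v , succV G v e , fromV

  -- Traversals are listed latest first.
  Follows : Sub → Trav → Trav → Set
  Follows G d d' = d ≡ φ G d'

  On : Sub → Trav → Set
  On G (v , e , _) = G v e ≡ true

  Mandatory : Sub → Fin n → Fin m → Set
  Mandatory G v e = ¬ IsHypertree X f (G ─ (v , e))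

  hypertree-connected : ∀ {G} → IsHypertree X f G → Connected G
  hypertree-connected {G} (T , (T⊆G , conn , _) , _) x y = Conn-mono {T} {G} T⊆G (conn x y)

  -- `e` serves as a target of the other colour, so that the path to it has a first edge.
  nbrV : ∀ {G} → Connected G → Fin m → ∀ v → ∃ λ e → G v e ≡ true
  nbrV conn e v with conn (inj₁ v) (inj₂ e)
  ... | _◅_ {j = inj₂ e'} a _ = e' , a

  nbrE : ∀ {G} → Connected G → Fin n → ∀ e → ∃ λ v → G v e ≡ true
  nbrE conn v e with conn (inj₂ e) (inj₁ v)
  ... | _◅_ {j = inj₁ v'} a _ = v' , a

  module Within {G : Sub} (G⊆Full : G ⊆ Full) where

    ∈atV : ∀ v e → G v e ≡ true → e ∈ atV v
    ∈atV v e Gve = Equivalence.from (atV-mem v e) (G⊆Full v e Gve)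

    ∈atE : ∀ e v → G v e ≡ true → v ∈ atE e
    ∈atE e v Gve = Equivalence.from (atE-mem e v) (G⊆Full v e Gve)

    φ-on : ∀ d → On G d → On G (φ G d)
    φ-on (v , e , fromV) Gve = cycSucc-sat (atE-unique e) (λ v' → G v' e) (∈atE e v Gve) Gve
    φ-on (v , e , fromE) Gve = cycSucc-sat (atV-unique v) (G v) (∈atV v e Gve) Gve

    orbitV : ∀ v (P : Fin m → Set) → (∀ e → G v e ≡ true → P e → P (succV G v e)) →
      ∀ {e} → G v e ≡ true → P e → ∀ e' → G v e' ≡ true → P e'
    orbitV v = cycSucc-orbit (atV-unique v) (G v) (∈atV v)

    orbitE : ∀ e (P : Fin n → Set) → (∀ v → G v e ≡ true → P v → P (succE G e v)) →
      ∀ {v} → G v e ≡ true → P v → ∀ v' → G v' e ≡ true → P v'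
    orbitE e = cycSucc-orbit (atE-unique e) (λ v → G v e) (∈atE e)

    φ-stable : ∀ {G'} → G' ⊆ G → ∀ d → On G' d → On G' (φ G d) → φ G' d ≡ φ G d
    φ-stable {G'} G'⊆G (v , e , fromV) d∈ φd∈ = cong (λ v' → v' , e , fromE)
      (cycSucc-stable (atE-unique e) (λ v' → G v' e) (λ v' → G' v' e) (λ v' → G'⊆G v' e)
        (∈atE e v (G'⊆G v e d∈)) d∈ φd∈)
    φ-stable {G'} G'⊆G (v , e , fromE) d∈ φd∈ = cong (λ e' → v , e' , fromV)
      (cycSucc-stable (atV-unique v) (G v) (G' v) (G'⊆G v) (∈atV v e (G'⊆G v e d∈)) d∈ φd∈)

    follows-stable : ∀ {G'} → G' ⊆ G → ∀ {ds} → All (On G') ds → Linked (Follows G) ds → Linked (Follows G') ds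
    follows-stable G'⊆G _ [] = []
    follows-stable G'⊆G _ [-] = [-]
    follows-stable {G'} G'⊆G (d∈ ∷ d'∈ ∷ ds∈) (_∷_ {y = d'} eq rs) =
      trans eq (sym (φ-stable {G'} G'⊆G d' d'∈ (subst (On G') eq d∈))) ∷ follows-stable {G'} G'⊆G (d'∈ ∷ ds∈) rs

    module Sweep (hyp : IsHypertree X f G) (O : Trav → Set) (O-on : ∀ d → O d → On G d)
      (O-mand : ∀ v e → O (v , e , fromV) → Mandatory G v e)
      (O-closed : ∀ d → O d → O (φ G d)) where

      Next : Trav → Trav → Set
      Next d d' = O d × d' ≡ φ G d

      Out : Fin n → Fin m → Set
      Out v e = O (v , e , fromV)

      In : Fin m → Fin n → Set
      In e v = O (v , e , fromE)

      tail : Trav → Node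
      tail (v , e , fromV) = inj₁ v
      tail (v , e , fromE) = inj₂ e

      tail-step : ∀ {d d'} → Next d d' → Directed Out In (tail d) (tail d')
      tail-step {v , e , fromV} (Od , refl) = out Od
      tail-step {v , e , fromE} (Od , refl) = in′ Od

      -- By `no-one-way` every violet exit in `O` comes with its reverse. This lets `O` rotate fully
      -- around each node it visits, and connectedness of `G` carries it to all nodes.
      covers : (∀ d d' → O d → O d' → Star Next d d') → ∀ d → O d →
        ∀ v e → G v e ≡ true → Out v e × In e v
      covers O-conn d Od v e Gve = Out-ve , fullE v e Out-ve v Gve
        where
        returns : ∀ v e → Out v e → In e v
        returns v e o = no-one-way H X f {G} hyp Out In O-mand (λ e v → O-on (v , e , fromE)) v e o
          (gmap tail tail-step (O-conn (φ G (v , e , fromV)) (v , e , fromV) (O-closed _ o) o))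
        -- From an exit along `e'`, the reverse dart re-enters `v`, and `φ G` of it is the exit
        -- along the next edge at `v`.
        fullV : ∀ v e → In e v → ∀ e' → G v e' ≡ true → Out v e'
        fullV v e i = orbitV v (Out v) (λ e' _ o → O-closed _ (returns v e' o)) (O-on _ (O-closed _ i)) (O-closed _ i)
        fullE : ∀ v e → Out v e → ∀ v' → G v' e ≡ true → In e v'
        fullE v e o = orbitE e (In e) (λ v' Gv'e i → O-closed _ (fullV v' e i e Gv'e)) (O-on _ (O-closed _ o)) (O-closed _ o)
        Visited : Node → Set
        Visited (inj₁ v) = ∃ λ e → In e v
        Visited (inj₂ e) = ∃ λ v → Out v e
        spread : ∀ {x y} → Conn G x y → Visited x → Visited y
        spread ε vis = vis
        spread (_◅_ {inj₁ v} {inj₂ e} s p) (e' , i) = spread p (v , fullV v e' i e s)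
        spread (_◅_ {inj₂ e} {inj₁ v} s p) (v' , o) = spread p (e , fullE v' e o v s)
        start : ∀ d → O d → ∃ Visited
        start (v , e , fromV) o = inj₂ e , v , o
        start (v , e , fromE) i = inj₁ v , e , i
        reach : ∀ x → Visited x
        reach x = spread (hypertree-connected {G} hyp (proj₁ (start d Od)) x) (proj₂ (start d Od))
        Out-ve : Out v e
        Out-ve = fullV v _ (proj₂ (reach (inj₁ v))) e Gve

      -- Listed latest first, c ∷ pre ++ [ c ] is one full period of a closed walk.
      module _ {c pre} (period : Linked (Follows G) (c ∷ pre ++ [ c ]))
               (⊆O : ∀ d → d ∈ pre ++ [ c ] → O d) where

        to-first : ∀ {x xs} → Linked (Follows G) (x ∷ xs) → (∀ d → d ∈ xs → O d) → ∀ {d} → d ∈ xs → Star Next d x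
        to-first (eq ∷ rs) ⊆O (here refl) = (⊆O _ (here refl) , eq) ◅ ε
        to-first (eq ∷ rs) ⊆O (there d∈) = to-first rs (λ d i → ⊆O d (there i)) d∈ ◅◅ (⊆O _ (here refl) , eq) ◅ ε

        from-last : ∀ xs → Linked (Follows G) (xs ++ [ c ]) → (∀ d → d ∈ xs ++ [ c ] → O d) →
          ∀ {d} → d ∈ xs ++ [ c ] → Star Next c d
        from-last [] _ _ (here refl) = ε
        from-last (x ∷ []) (eq ∷ rs) ⊆O (here refl) = (⊆O _ (there (here refl)) , eq) ◅ ε
        from-last (x ∷ y ∷ xs) (eq ∷ rs) ⊆O (here refl) =
          from-last (y ∷ xs) rs (λ d i → ⊆O d (there i)) (here refl) ◅◅ (⊆O _ (there (here refl)) , eq) ◅ ε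
        from-last (x ∷ []) (eq ∷ rs) ⊆O (there d∈) = from-last [] rs (λ d i → ⊆O d (there i)) d∈
        from-last (x ∷ y ∷ xs) (eq ∷ rs) ⊆O (there d∈) = from-last (y ∷ xs) rs (λ d i → ⊆O d (there i)) d∈

        period-connected : ∀ {d d'} → d ∈ pre ++ [ c ] → d' ∈ pre ++ [ c ] → Star Next d d'
        period-connected d∈ d'∈ = to-first period ⊆O d∈ ◅◅ from-last pre (Linked.tail period) ⊆O d'∈

    -- Lists run backwards in time, so the successor of an entry is its left neighbour.
    successor-∈ : ∀ {x} xs {ys} → Linked (Follows G) (x ∷ xs ++ ys) → ∀ {d} → d ∈ xs → φ G d ∈ x ∷ xs
    successor-∈ (_ ∷ xs) (eq ∷ rs) (here refl) = here (sym eq)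
    successor-∈ (_ ∷ xs) (eq ∷ rs) (there d∈) = there (successor-∈ xs rs d∈)

    -- `Sweep` is applied to the darts of one period: they are closed under `φ G` because the
    -- leading `c` recurs at the end, which also makes any of them reachable from any other.
    period-covers : IsHypertree X f G → ∀ c pre → Linked (Follows G) (c ∷ pre ++ [ c ]) →
      All (On G) (pre ++ [ c ]) → (∀ v e → (v , e , fromV) ∈ pre ++ [ c ] → Mandatory G v e) →
      ∀ v e → G v e ≡ true → (v , e , fromV) ∈ pre ++ [ c ] × (v , e , fromE) ∈ pre ++ [ c ]
    period-covers hyp c pre period on mand = covers (λ d d' → period-connected period (λ _ i → i)) c c∈
      where
      c∈ : c ∈ pre ++ [ c ]
      c∈ = ∈-++⁺ʳ pre (here refl)
      closed : ∀ d → d ∈ pre ++ [ c ] → φ G d ∈ pre ++ [ c ]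
      closed d d∈ with successor-∈ (pre ++ [ c ]) {[]} (subst (λ l → Linked (Follows G) (c ∷ l)) (sym (++-identityʳ _)) period) d∈
      ... | here eq = subst (_∈ pre ++ [ c ]) (sym eq) c∈
      ... | there i = i
      open Sweep hyp (_∈ pre ++ [ c ]) (λ d → All.lookup on) mand closed

  -- If the current edge v e was traversed from e and were removable, the traversals made since
  -- would be a closed walk in G ─ (v , e), hence visit e; turning around e, they then meet v e.
  removal-fresh : ∀ {G v e tr} → G ⊆ Full → G v e ≡ true → IsHypertree X f (G ─ (v , e)) →
    Linked (Follows G) ((v , e , fromV) ∷ tr) → All (On G) tr → Unique tr →
    (∀ v' e' → (v' , e' , fromV) ∈ tr → Mandatory G v' e') → (v , e , fromE) ∉ tr
  removal-fresh {G} {v} {e} G⊆Full Gve hyp chain on uniq mand d∈ with ∈-∃++ d∈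
  ... | pre , post , refl = no-period refl (initLast pre)
    where
    open Within {G} G⊆Full
    G₁ : Sub
    G₁ = G ─ (v , e)
    G₁⊆G : G₁ ⊆ G
    G₁⊆G = ─-⊆ G (v , e)
    module W₁ = Within {G₁} (λ v' e' h → G⊆Full v' e' (G₁⊆G v' e' h))
    conn₁ : Connected G₁
    conn₁ = hypertree-connected {G₁} hyp
    c d : Trav
    c = v , e , fromV
    d = v , e , fromE
    d∉pre : d ∉ pre
    d∉pre = proj₁ (unique-split pre uniq)
    c∉pre : c ∉ pre
    c∉pre c∈ = mand v e (∈-++⁺ˡ c∈) hyp
    chain' : Linked (Follows G) (c ∷ pre ++ [ d ])
    chain' = linked-truncate (c ∷ pre) chain
    on₁ : ∀ {x} → x ∈ pre → On G₁ x
    on₁ {v' , e' , s} x∈ = ─-kept G v e (All.lookup on (∈-++⁺ˡ x∈)) (off s x∈)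
      where
      off : ∀ s → (v' , e' , s) ∈ pre → (v' , e') ≢ (v , e)
      off fromV x∈ refl = c∉pre x∈
      off fromE x∈ refl = d∉pre x∈
    mand₁ : ∀ v' e' → (v' , e' , fromV) ∈ pre → Mandatory G₁ v' e'
    mand₁ v' e' x∈ hyp' = mand v' e' (∈-++⁺ˡ x∈)
      (hypertree-mono X f {G₁ ─ (v' , e')} {G ─ (v' , e')} (─-mono {G₁} {G} (v' , e') G₁⊆G) hyp')

    last-dart : ∀ ys {x} → Linked (Follows G) ((ys ∷ʳ x) ∷ʳ d) → x ≡ φ G d
    last-dart [] (eq ∷ _) = eq
    last-dart (_ ∷ []) (_ ∷ rs) = last-dart [] rs
    last-dart (_ ∷ y ∷ ys) (_ ∷ rs) = last-dart (y ∷ ys) rs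

    first-dart : ∀ {q qs} → pre ≡ q ∷ qs → c ≡ φ G q
    first-dart refl with chain'
    ... | eq ∷ _ = eq

    turn : ∀ q {qs} → pre ≡ q ∷ qs → ∀ xs {x} → pre ≡ xs ∷ʳ x → ⊥
    turn (_ , _ , fromV) eq _ _ with first-dart eq
    ... | ()
    turn q@(v' , e' , fromE) {qs} eq xs {x} snoc with cong proj₁ (first-dart eq)
    ... | refl = c∉pre (orbitE e (λ y → (y , e , fromV) ∈ pre) closed (G₁⊆G _ e (proj₂ nbr)) (covered _ e (proj₂ nbr)) v Gve)
      where
      q∈ : q ∈ pre
      q∈ = subst (q ∈_) (sym eq) (here refl)
      e'≢e : e' ≢ e
      e'≢e refl = d∉pre q∈
      nbr : ∃ λ u → G₁ u e ≡ true
      nbr = nbrE {G₁} conn₁ v e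
      -- `q`, the last dart before `c`, enters `v` along the edge preceding `e`; `x`, the first dart
      -- after `d`, leaves `v` along the edge following `e`. Deleting `e` makes these edges
      -- consecutive, so `pre` becomes a full period in `G₁`.
      x≡φ₁q : x ≡ φ G₁ q
      x≡φ₁q = trans (last-dart (c ∷ xs) (subst (λ l → Linked (Follows G) (c ∷ l ∷ʳ d)) snoc chain'))
        (cong (λ z → v , z , fromV) (sym (cycSucc-remove (atV-unique v) (G v) (∈atV v) (G₁ v)
          (─-removed G v e) (λ z z≢e → sym (─-other G v e {v} {z} (z≢e ∘ cong proj₂)))
          (G₁⊆G v e' (on₁ q∈)) e'≢e (sym (cong (proj₁ ∘ proj₂) (first-dart eq))))))
      chain₁ : Linked (Follows G₁) pre
      chain₁ = follows-stable {G₁} G₁⊆G (All.tabulate on₁) (linked-prefix pre (Linked.tail chain'))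
      period : Linked (Follows G₁) (x ∷ xs ∷ʳ x)
      period = subst (λ l → Linked (Follows G₁) (x ∷ l)) (trans (sym eq) snoc)
        (x≡φ₁q ∷ subst (Linked (Follows G₁)) eq chain₁)
      covered : ∀ v' e' → G₁ v' e' ≡ true → (v' , e' , fromV) ∈ pre
      covered v' e' h = subst (_ ∈_) (sym snoc) (proj₁ (W₁.period-covers hyp x xs period
        (All.tabulate (on₁ ∘ subst (_ ∈_) (sym snoc))) (λ v e → mand₁ v e ∘ subst (_ ∈_) (sym snoc)) v' e' h))
      -- After arriving at `e` from `y`, the walk leaves along the next edge at `e` in `G`. That
      -- dart lies in `pre`, so its edge is in `G₁` and is also covered from its violet end. The
      -- rotation eventually reaches `v`, forcing `c` into `pre`.
      closed : ∀ y → G y e ≡ true → (y , e , fromV) ∈ pre → (succE G e y , e , fromV) ∈ pre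
      closed y _ y∈ with successor-∈ pre chain' y∈
      ... | there i = covered _ e (on₁ i)

    no-period : ∀ {ds} → pre ≡ ds → InitLast ds → ⊥
    -- With `pre` empty, `e` would be its own successor at `v`, although `v` has another neighbour
    -- in the connected graph `G₁`.
    no-period eq [] with subst (λ l → Linked (Follows G) (c ∷ l ∷ʳ d)) eq chain' | nbrV {G₁} conn₁ e v
    ... | follows ∷ _ | e' , Gve' = cycSucc-≢ (atV-unique v) (G v) (∈atV v) (G₁⊆G v e' Gve') Gve
      (─-≢ G v e {v} {e'} Gve' ∘ cong (v ,_)) (sym (cong (proj₁ ∘ proj₂) follows))
    no-period eq ([] ∷ʳ′ x) = turn x eq [] eq
    no-period eq ((q ∷ qs) ∷ʳ′ x) = turn q eq (q ∷ qs) eq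

  -- The invariant of the process

  current : State → Trav
  current (st G v e tr hs) = v , e , fromV

  -- `chain` and `on` include the pending dart of the current edge, while `mand` and `uniq` concern
  -- completed traversals. The `hist` fields identify the history with the removed edges and those
  -- traversed from their violet end.
  record Inv (s : State) : Set where
    constructor inv
    open State s
    field
      hyp : IsHypertree X f graph
      ⊆Full : graph ⊆ Full
      chain : Linked (Follows graph) (current s ∷ traversed)
      on : All (On graph) (current s ∷ traversed)
      mand : ∀ v e → (v , e , fromV) ∈ traversed → Mandatory graph v e
      uniq : Unique traversed
      hist-uniq : Unique history
      hist-sound : ∀ v e → (v , e) ∈ history → H e v ≡ true × (graph v e ≡ false ⊎ (v , e , fromV) ∈ traversed)
      hist-removed : ∀ v e → H e v ≡ true → graph v e ≡ false → (v , e) ∈ history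
      hist-traversed : ∀ v e → (v , e , fromV) ∈ traversed → (v , e) ∈ history

  -- A past current edge was either removed, but the pending edge is in the graph, or traversed from
  -- its violet end.
  hist-fresh : ∀ {s} → Inv s → current s ∉ State.traversed s → (State.curV s , State.curE s) ∉ State.history s
  hist-fresh {st G v e tr hs} I c∉ ve∈ with Inv.hist-sound I v e ve∈
  ... | _ , inj₁ Gve≡false = contradiction (trans (sym (All.head (Inv.on I))) Gve≡false) λ ()
  ... | _ , inj₂ c∈ = c∉ c∈

  snoc-unique : ∀ {hs : List Edge} {x} → Unique hs → x ∉ hs → Unique (hs ++ [ x ])
  snoc-unique u x∉ = Unique.++⁺ u ([] ∷ []) λ { (x∈ , here refl) → x∉ x∈ }

  init-inv : IsHypertree X f Full → ∀ b₀ b₁ b → Inv (init b₀ b₁ b)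
  init-inv hyp (inj₁ v) (inj₂ e) b = inv hyp (λ _ _ h → h) [-] (b ∷ []) (λ _ _ ()) [] []
    (λ _ _ ()) (λ _ _ h h' → contradiction (trans (sym h) h') λ ()) (λ _ _ ())
  -- With an emerald base node, one traversal from the emerald end is recorded at the start and the
  -- pending dart is its `φ` successor; the history is still empty.
  init-inv hyp (inj₂ e) (inj₁ v) b = inv hyp (λ _ _ h → h) (refl ∷ [-])
    (Within.φ-on {Full} (λ _ _ h → h) (v , e , fromE) b ∷ b ∷ []) (λ { _ _ (here ()) ; _ _ (there ()) }) ([] ∷ []) []
    (λ _ _ ()) (λ _ _ h h' → contradiction (trans (sym h) h') λ ()) (λ { _ _ (here ()) ; _ _ (there ()) })

  step-inv : ∀ {s s'} → Inv s → Step s s' → Inv s'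
  step-inv I@(inv hyp ⊆Full chain (Gve ∷ on) mand uniq hist-uniq hist-sound hist-removed hist-traversed)
    (removeStep {G} {v} {e} {tr} {hs} hyp₁) = record
    { hyp = hyp₁
    ; ⊆Full = λ v' e' h → ⊆Full v' e' (G₁⊆G v' e' h)
    ; chain = chain₁ chain on₁
    ; on = next-on ∷ on₁
    -- A smaller graph has fewer realizing trees, so mandatory edges stay mandatory.
    ; mand = λ v' e' i hyp' → mand v' e' i
        (hypertree-mono X f {G₁ ─ (v' , e')} {G ─ (v' , e')} (─-mono {G₁} {G} (v' , e') G₁⊆G) hyp')
    ; uniq = uniq
    ; hist-uniq = snoc-unique hist-uniq (hist-fresh I c∉)
    ; hist-sound = sound₁
    ; hist-removed = removed₁
    ; hist-traversed = λ v' e' i → ∈-++⁺ˡ (hist-traversed v' e' i)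
    }
    where
    open Within {G} ⊆Full
    G₁ : Sub
    G₁ = G ─ (v , e)
    G₁⊆G : G₁ ⊆ G
    G₁⊆G = ─-⊆ G (v , e)
    c∉ : (v , e , fromV) ∉ tr
    c∉ c∈ = mand v e c∈ hyp₁
    back∉ : (v , e , fromE) ∉ tr
    back∉ = removal-fresh {G} ⊆Full Gve hyp₁ chain on uniq mand
    on₁ : All (On G₁) tr
    on₁ = All.tabulate on₁′
      where
      on₁′ : ∀ {d} → d ∈ tr → On G₁ d
      on₁′ {v' , e' , s} d∈ = ─-kept G v e (All.lookup on d∈) (off s d∈)
        where
        off : ∀ s → (v' , e' , s) ∈ tr → (v' , e') ≢ (v , e)
        off fromV d∈ refl = c∉ d∈
        off fromE d∈ refl = back∉ d∈
    next≢e : succV G v e ≢ e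
    next≢e with nbrV {G₁} (hypertree-connected {G₁} hyp₁) e v
    ... | e' , G₁ve' = cycSucc-≢ (atV-unique v) (G v) (∈atV v) (G₁⊆G v e' G₁ve') Gve
      (─-≢ G v e {v} {e'} G₁ve' ∘ cong (v ,_))
    next-on : G₁ v (succV G v e) ≡ true
    next-on = ─-kept G v e (φ-on (v , e , fromE) Gve) (next≢e ∘ cong proj₂)
    -- Only the link into the pending dart changes: the last dart entered `v` along the edge
    -- preceding `e`, whose successor in `G₁` is the old successor of `e`.
    chain₁ : ∀ {tr} → Linked (Follows G) ((v , e , fromV) ∷ tr) → All (On G₁) tr →
      Linked (Follows G₁) ((v , succV G v e , fromV) ∷ tr)
    chain₁ [-] _ = [-]
    chain₁ (_∷_ {y = _ , e' , fromE} eq rs) (d∈ ∷ ds∈) with cong proj₁ eq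
    ... | refl = cong (λ z → v , z , fromV) (sym (cycSucc-remove (atV-unique v) (G v) (∈atV v) (G₁ v)
        (─-removed G v e) (λ z z≢e → sym (─-other G v e {v} {z} (z≢e ∘ cong proj₂)))
        (G₁⊆G v e' d∈) (─-≢ G v e {v} {e'} d∈ ∘ cong (v ,_)) (sym (cong (proj₁ ∘ proj₂) eq))))
      ∷ follows-stable {G₁} G₁⊆G (d∈ ∷ ds∈) rs
    sound₁ : ∀ v' e' → (v' , e') ∈ hs ++ [ (v , e) ] → H e' v' ≡ true × (G₁ v' e' ≡ false ⊎ (v' , e' , fromV) ∈ tr)
    sound₁ v' e' i with ∈-++⁻ hs i
    ... | inj₂ (here refl) = ⊆Full v e Gve , inj₁ (─-removed G v e)
    ... | inj₁ i' with hist-sound v' e' i' | (v' , e') ≟ₑ (v , e)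
    ...   | h , inj₂ d∈ | _ = h , inj₂ d∈
    ...   | h , inj₁ _ | yes refl = h , inj₁ (─-removed G v e)
    ...   | h , inj₁ gone | no ne = h , inj₁ (trans (─-other G v e ne) gone)
    removed₁ : ∀ v' e' → H e' v' ≡ true → G₁ v' e' ≡ false → (v' , e') ∈ hs ++ [ (v , e) ]
    removed₁ v' e' h gone with (v' , e') ≟ₑ (v , e)
    ... | yes refl = ∈-++⁺ʳ hs (here refl)
    ... | no ne = ∈-++⁺ˡ (hist-removed v' e' h (trans (sym (─-other G v e ne)) gone))
  step-inv I@(inv hyp ⊆Full chain (Gve ∷ on) mand uniq hist-uniq hist-sound hist-removed hist-traversed)
    (traverseStep {G} {v} {e} {tr} {hs} ¬hyp₁ c∉ d∉) = record
    { hyp = hyp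
    ; ⊆Full = ⊆Full
    ; chain = refl ∷ refl ∷ chain
    ; on = φ-on (φ G c) (φ-on c Gve) ∷ φ-on c Gve ∷ Gve ∷ on
    ; mand = λ { _ _ (there (here refl)) → ¬hyp₁ ; v' e' (there (there i)) → mand v' e' i }
    ; uniq = All.tabulate (λ { (here refl) () ; (there i) refl → d∉ i })
        ∷ All.tabulate (λ { i refl → c∉ i }) ∷ uniq
    ; hist-uniq = snoc-unique hist-uniq (hist-fresh I c∉)
    ; hist-sound = sound₁
    ; hist-removed = λ v' e' h gone → ∈-++⁺ˡ (hist-removed v' e' h gone)
    ; hist-traversed = λ { _ _ (there (here refl)) → ∈-++⁺ʳ hs (here refl)
                         ; v' e' (there (there i)) → ∈-++⁺ˡ (hist-traversed v' e' i) }
    }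
    where
    open Within {G} ⊆Full
    c : Trav
    c = v , e , fromV
    sound₁ : ∀ v' e' → (v' , e') ∈ hs ++ [ (v , e) ] →
      H e' v' ≡ true × (G v' e' ≡ false ⊎ (v' , e' , fromV) ∈ φ G c ∷ c ∷ tr)
    sound₁ v' e' i with ∈-++⁻ hs i
    ... | inj₂ (here refl) = ⊆Full v e Gve , inj₂ (there (here refl))
    ... | inj₁ i' with hist-sound v' e' i'
    ...   | h , inj₁ gone = h , inj₁ gone
    ...   | h , inj₂ d∈ = h , inj₂ (there (there d∈))

  steps-inv : ∀ {s s'} → Inv s → Star Step s s' → Inv s'
  steps-inv I ε = I
  steps-inv I (s ◅ ss) = steps-inv (step-inv I s) ss

  -- A realizing tree inside `G` contains every mandatory edge, so it agrees with `G` pointwise.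
  all-mandatory⇒tree : ∀ {G} → IsHypertree X f G → G ⊆ Full → (∀ v e → G v e ≡ true → Mandatory G v e) →
    IsSpanningTree Full G × Realizes X f G
  all-mandatory⇒tree {G} (T , tree@(T⊆G , _) , real) G⊆Full mand =
    spanningTree-resp {Full} {T} {G} T≗G
      (spanning-⊆ {G} {Full} {T} (λ v e h → G⊆Full v e (T⊆G v e h)) tree) , realizes-resp X f {T} {G} T≗G real
    where
    T≗G : ∀ v e → T v e ≡ G v e
    T≗G v e with T v e in Tve | G v e in Gve
    ... | true | true = refl
    ... | false | false = refl
    ... | true | false = trans (sym (T⊆G v e Tve)) Gve
    ... | false | true = contradiction (hypertree-avoid X f {G} {T} tree real Tve) (mand v e Gve)

  Outcome : Sub → List Edge → Set
  Outcome T hs = Unique hs × (∀ v e → ((v , e) ∈ hs) ⇔ (H e v ≡ true)) × IsSpanningTree Full T × Realizes X f T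

  -- The repeated dart closes a period of the face walk. By `period-covers` every remaining edge has
  -- been traversed from its violet end, hence is mandatory and recorded.
  ends-outcome : ∀ {s T hs} → Inv s → Ends s T hs → Outcome T hs
  ends-outcome {hs = hs} I@(inv hyp ⊆Full chain on mand _ hist-uniq hist-sound hist-removed hist-traversed)
    (stopAtVE {G} {v} {e} {tr} ¬hyp₁ c∈) with ∈-∃++ c∈
  ... | pre , post , refl = hist-uniq , (λ v' e' → mk⇔ (proj₁ ∘ hist-sound v' e') (complete v' e')) ,
      all-mandatory⇒tree {G} hyp ⊆Full λ v' e' h → mand v' e' (traversed v' e' h)
    where
    open Within {G} ⊆Full
    c : Trav
    c = v , e , fromV
    pre⊆tr : ∀ {d} → d ∈ pre ++ [ c ] → d ∈ pre ++ c ∷ post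
    pre⊆tr {x} i = subst (x ∈_) (++-assoc pre [ c ] post) (∈-++⁺ˡ i)
    traversed : ∀ v' e' → G v' e' ≡ true → (v' , e' , fromV) ∈ tr
    traversed v' e' h = pre⊆tr (proj₁ (period-covers hyp c pre (linked-truncate (c ∷ pre) chain)
      (All.tabulate λ i → All.lookup on (there (pre⊆tr i))) (λ v e i → mand v e (pre⊆tr i)) v' e' h))
    complete : ∀ v' e' → H e' v' ≡ true → (v' , e') ∈ hs
    complete v' e' h with G v' e' Bool.≟ true
    ... | yes Gve = hist-traversed v' e' (traversed v' e' Gve)
    ... | no ¬Gve = hist-removed v' e' h (Bool.¬-not ¬Gve)
  ends-outcome I@(inv hyp ⊆Full chain on mand _ hist-uniq hist-sound hist-removed hist-traversed)
    (stopAtEW {G} {v} {e} {tr} {hs} ¬hyp₁ c∉ d∈) with ∈-∃++ d∈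
  -- Here `v e` has not been traversed from `v`, so this is its first time as current edge and it is
  -- appended to the history.
  ... | pre , post , refl = snoc-unique hist-uniq (hist-fresh I c∉) , (λ v' e' → mk⇔ (sound v' e') (complete v' e')) ,
      all-mandatory⇒tree {G} hyp ⊆Full λ v' e' h → mand′ v' e' (traversed v' e' h)
    where
    open Within {G} ⊆Full
    c d : Trav
    c = v , e , fromV
    d = φ G c
    pre⊆tr : ∀ {x} → x ∈ c ∷ pre ++ [ d ] → x ∈ c ∷ pre ++ d ∷ post
    pre⊆tr {x} i = subst (x ∈_) (++-assoc (c ∷ pre) [ d ] post) (∈-++⁺ˡ i)
    mand′ : ∀ v' e' → (v' , e' , fromV) ∈ c ∷ tr → Mandatory G v' e'
    mand′ _ _ (here refl) = ¬hyp₁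
    mand′ v' e' (there i) = mand v' e' i
    -- The period is `d ∷ c ∷ pre ++ [ d ]`. It includes the pending `c`, which is mandatory by
    -- `¬hyp₁`.
    traversed : ∀ v' e' → G v' e' ≡ true → (v' , e' , fromV) ∈ c ∷ tr
    traversed v' e' h = pre⊆tr (proj₁ (period-covers hyp d (c ∷ pre) (refl ∷ linked-truncate (c ∷ pre) chain)
      (All.tabulate λ i → All.lookup on (pre⊆tr i)) (λ v e i → mand′ v e (pre⊆tr i)) v' e' h))
    sound : ∀ v' e' → (v' , e') ∈ hs ++ [ (v , e) ] → H e' v' ≡ true
    sound v' e' i with ∈-++⁻ hs i
    ... | inj₁ i' = proj₁ (hist-sound v' e' i')
    ... | inj₂ (here refl) = ⊆Full v e (All.head on)
    recorded : ∀ v' e' → (v' , e' , fromV) ∈ c ∷ tr → (v' , e') ∈ hs ++ [ (v , e) ]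
    recorded _ _ (here refl) = ∈-++⁺ʳ hs (here refl)
    recorded v' e' (there i) = ∈-++⁺ˡ (hist-traversed v' e' i)
    complete : ∀ v' e' → H e' v' ≡ true → (v' , e') ∈ hs ++ [ (v , e) ]
    complete v' e' h with G v' e' Bool.≟ true
    ... | yes Gve = recorded v' e' (traversed v' e' Gve)
    ... | no ¬Gve = ∈-++⁺ˡ (hist-removed v' e' h (Bool.¬-not ¬Gve))

  -- Termination

  progress : ∀ s → (∃ λ T → ∃ λ hs → Ends s T hs) ⊎
    (∃ λ s' → Step s s' × length (State.history s') ≡ suc (length (State.history s)))
  progress (st G v e tr hs) with hypertree? X f (G ─ (v , e)) 
    | DecMembership._∈?_ _≟ₜ_ (v , e , fromV) tr | DecMembership._∈?_ _≟ₜ_ (succE G e v , e , fromE) tr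
  ... | yes hyp | _ | _ = inj₂ (_ , removeStep hyp , trans (length-++ hs) (ℕ.+-comm _ 1))
  ... | no ¬hyp | yes c∈ | _ = inj₁ (_ , _ , stopAtVE ¬hyp c∈)
  ... | no ¬hyp | no c∉ | yes d∈ = inj₁ (_ , _ , stopAtEW ¬hyp c∉ d∈)
  ... | no ¬hyp | no c∉ | no d∉ = inj₂ (_ , traverseStep ¬hyp c∉ d∉ , trans (length-++ hs) (ℕ.+-comm _ 1))

  unique-edges-bounded : ∀ {hs : List Edge} → Unique hs → length hs ≤ n * m
  unique-edges-bounded {hs} u = injective⇒≤ {f = λ i → uncurry combine (lookup hs i)} λ {i} {j} eq →
    lookup-injective u i j (uncurry (cong₂ _,_) (combine-injective _ _ _ _ eq))

  -- Each step adds one edge to a history without repetitions. Fuel zero would mean `suc (n * m)`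
  -- distinct edges among at most `n * m`.
  terminates : ∀ fuel s → Inv s → fuel + length (State.history s) ≡ suc (n * m) →
    ∃ λ s' → ∃ λ T → ∃ λ hs → Star Step s s' × Ends s' T hs
  terminates zero s I len≡ = contradiction (unique-edges-bounded (Inv.hist-uniq I)) (ℕ.<⇒≱ (ℕ.≤-reflexive (sym len≡)))
  terminates (suc fuel) s I len≡ with progress s
  ... | inj₁ (T , hs , ends) = s , T , hs , ε , ends
  ... | inj₂ (s' , step , len') with terminates fuel s' (step-inv I step)
      (trans (cong (fuel +_) len') (trans (ℕ.+-suc fuel _) len≡))
  ...   | s″ , T , hs , steps , ends = s″ , T , hs , step ◅ steps , ends

theorem4p5 : ∀ {n m : ℕ} (H : Fin m → Fin n → Bool) →
    (∀ e → ∃ λ v → H e v ≡ true) →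
    Bip.Connected H (Bip.Full H) →
    (ρ : Bip.Ribbon H) (b0 b1 : Bip.Node H) (b : Bip.Adj H (Bip.Full H) b0 b1) →
    (X : Color) (f : Bip.Weight H X) → Bip.IsHypertree H X f (Bip.Full H) →
    let open Bip H in
    let open Process ρ X f in
    (∃ λ s → ∃ λ T → ∃ λ hs → Star Step (init b0 b1 b) s × Ends s T hs) ×
    (∀ s T hs → Star Step (init b0 b1 b) s → Ends s T hs →
    Unique hs × (∀ v e → ((v , e) ∈ hs) ⇔ (H e v ≡ true)) ×
    IsSpanningTree Full T × Realizes X f T)
theorem4p5 H _ _ ρ b0 b1 b X f hyp =
  terminates ρ X f _ _ start (ℕ.m∸n+n≡m short) ,
  λ s T hs steps ends → ends-outcome ρ X f (steps-inv ρ X f start steps) ends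
  where
  start = init-inv ρ X f hyp b0 b1 b
  -- The initial history is empty, but `init` does not reduce for variable base nodes; the general
  -- bound covers both cases at once.
  short = ℕ.m≤n⇒m≤1+n (unique-edges-bounded ρ X f (Inv.hist-uniq start))
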